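{- For every graph $G$ we have $t_\ell(G)\leq\mathrm{stw}(G)$.
   Context: All graphs are finite and simple. A simple $k$-tree is a graph obtainable by starting with a $(k+1)$-clique and repeatedly adding a new vertex adjacent exactly to the vertices of some $k$-clique of the current graph, such that no two vertices are added onto the same $k$-clique. The simple tree-width $\mathrm{stw}(G)$ is the minimum $k$ such that $G$ is a subgraph of some simple $k$-tree. An interval graph is the intersection graph of a finite family of intervals of the real line. The local track-number $t_\ell(G)$ is the minimum, over all families of interval graphs $I_1,\dots,I_k$ that are subgraphs of $G$ and whose edge sets together cover $E(G)$ ($k$ arbitrary), of the maximum over vertices $v$ of $G$ of the number of indices $i$ with $v\in V(I_i)$. -}

module Defs where

open import Data.Nat using (ℕ; zero; suc; _≤_; _<_)
open import Data.Bool using (Bool; true; false; if_then_else_)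
open import Data.Fin using (Fin; toℕ)
open import Data.Fin.Subset using (Subset; _∈_; ∣_∣)
open import Data.List using (List; []; _∷_)
open import Data.List.Relation.Unary.Any using (Any)
open import Data.Product using (Σ; _×_)
open import Data.Sum using (_⊎_)
open import Relation.Binary.PropositionalEquality using (_≡_; _≢_)
open import Function.Definitions using (Injective)

record Graph (n : ℕ) : Set where
  field
    adj    : Fin n → Fin n → Bool
    sym    : ∀ u v → adj u v ≡ adj v u
    irrefl : ∀ v → adj v v ≡ false
open Graph public

-- A simple k-tree on m vertices, with vertices labelled 0,1,…,m-1 in the
-- order in which they are created by the construction.
-- parents j is the set of earlier vertices j is adjacent to when created.
-- Vertices 0..k form the initial (k+1)-clique (parents j = {i | i < j});
-- every later vertex j is attached to a k-clique of the graph on earlier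
-- vertices, and distinct later vertices are attached to distinct k-cliques.
record SimpleKTree (k m : ℕ) : Set where
  field
    parents      : Fin m → Subset m
    enough       : k < m
    initial-sub  : ∀ (j i : Fin m) → toℕ j ≤ k → i ∈ parents j → toℕ i < toℕ j
    initial-sup  : ∀ (j i : Fin m) → toℕ j ≤ k → toℕ i < toℕ j → i ∈ parents j
    later-below  : ∀ (j i : Fin m) → k < toℕ j → i ∈ parents j → toℕ i < toℕ j
    later-size   : ∀ (j : Fin m) → k < toℕ j → ∣ parents j ∣ ≡ k
    later-clique : ∀ (j a b : Fin m) → k < toℕ j → a ∈ parents j → b ∈ parents j →
                   toℕ a < toℕ b → a ∈ parents b
    later-simple : ∀ (j j′ : Fin m) → k < toℕ j → k < toℕ j′ →
                   parents j ≡ parents j′ → j ≡ j′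
open SimpleKTree public

TreeAdj : ∀ {k m} → SimpleKTree k m → Fin m → Fin m → Set
TreeAdj T a b = (toℕ a < toℕ b × a ∈ parents T b) ⊎ (toℕ b < toℕ a × b ∈ parents T a)

SubgraphOfKTree : ∀ {n k m} → Graph n → SimpleKTree k m → Set
SubgraphOfKTree {n} {k} {m} G T =
  Σ (Fin n → Fin m) λ f → Injective _≡_ _≡_ f ×
    (∀ u v → adj G u v ≡ true → TreeAdj T (f u) (f v))

-- An interval graph that is a subgraph of G: vertex set {v | inV v ≡ true},
-- each such vertex v carries the closed interval [left v , right v], and the
-- edges are the pairs of distinct vertices whose intervals intersect; all of
-- these must be edges of G.
record IntervalSubgraph {n : ℕ} (G : Graph n) : Set where
  field
    inV   : Fin n → Bool
    left  : Fin n → ℕ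
    right : Fin n → ℕ
    nonempty : ∀ v → left v ≤ right v
    sub   : ∀ u v → u ≢ v → inV u ≡ true → inV v ≡ true →
            left u ≤ right v → left v ≤ right u → adj G u v ≡ true
open IntervalSubgraph public

EdgeOf : ∀ {n} {G : Graph n} → IntervalSubgraph G → Fin n → Fin n → Set
EdgeOf I u v = inV I u ≡ true × inV I v ≡ true × left I u ≤ right I v × left I v ≤ right I u

countContaining : ∀ {n} {G : Graph n} → Fin n → List (IntervalSubgraph G) → ℕ
countContaining v [] = zero
countContaining v (I ∷ Is) =
  if inV I v then suc (countContaining v Is) else countContaining v Is

LocalTrackAtMost : ∀ {n} → Graph n → ℕ → Set
LocalTrackAtMost {n} G k =
  Σ (List (IntervalSubgraph G)) λ Is →
    (∀ u v → adj G u v ≡ true → Any (λ I → EdgeOf I u v) Is) ×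
    (∀ v → countContaining v Is ≤ k)

{-# OPTIONS --safe #-}
module Submission where

open import Defs hiding (sym)
open import Data.Bool using (Bool; true; false; if_then_else_)
import Data.Bool.Properties as Bool
open import Data.Empty using (⊥)
open import Data.Fin using (Fin; toℕ; fromℕ<; zero; suc)
open import Data.Fin.Properties using (_≟_; any?; toℕ-injective; toℕ<n; toℕ-fromℕ<)
open import Data.Fin.Subset using (Subset; _∈_; _∉_; ∣_∣; _⊆_; inside; outside)
open import Data.Fin.Subset.Properties using (_∈?_; ⊆-antisym; p⊂q⇒∣p∣<∣q∣; drop-there)
open import Data.List using (List; []; _∷_; _++_; length; map; filter; allFin; cartesianProduct)
open import Data.List.Properties using (length-map; length-++; filter-notAll)
import Data.List.Membership.Propositional as L
import Data.List.Membership.Propositional.Properties as L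
import Data.List.Membership.DecPropositional as DecMembership
open import Data.List.Relation.Unary.All using (All; []; _∷_; all?)
import Data.List.Relation.Unary.All as All
import Data.List.Relation.Unary.All.Properties as All
open import Data.List.Relation.Unary.Any using (Any; here; there)
import Data.List.Relation.Unary.Any as Any
import Data.List.Relation.Unary.Any.Properties as Any
open import Data.List.Relation.Unary.AllPairs using ([]; _∷_)
open import Data.List.Relation.Unary.Unique.Propositional using (Unique)
import Data.List.Relation.Unary.Unique.Propositional.Properties as Unique
open import Data.Nat using (ℕ; zero; suc; _+_; _*_; _≤_; _<_; z≤n; s≤s; _≤?_; _<?_)
open import Data.Nat.Properties hiding (_≟_)
open import Data.Product using (Σ; ∃; ∃₂; _×_; _,_; proj₁; proj₂)
open import Data.Product.Properties using (≡-dec)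
open import Data.Sum using (_⊎_; inj₁; inj₂; [_,_]′)
open import Data.Vec using ([]; _∷_; here; there)
open import Function using (_∘_; id; case_of_; mk⇔)
open import Function.Definitions using (Injective)
open import Relation.Binary.PropositionalEquality
  using (_≡_; _≢_; refl; sym; trans; cong; cong₂; subst; subst₂)
open import Relation.Binary using (tri<; tri≈; tri>)
open import Relation.Nullary.Decidable using (decidable-stable; dec-true; dec-false; does-⇔)
open import Relation.Nullary using (¬_; Dec; yes; no; does; contradiction; _×-dec_; ¬?)

-- Take G to be a spanning subgraph of the k-tree and process the vertices in the order of their
-- creation. A vertex w joins the graphs of its G-neighbours among its k parents, as a short
-- interval inside a part of the line covered by the neighbour only, and opens a graph of its own
-- to receive its children. This puts w in at most k graphs unless w is G-adjacent to all its
-- parents; then one graph has to be saved, in one of two ways. Either two parents a, b overlap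
-- somewhere alone (a pair), and w is put there; or w begins its own interval at a free end of an
-- interval of a parent (a token). A free end can be used only once, which is enough because
-- distinct vertices are attached to distinct cliques. Indeed, consider the clique formed by w and
-- all its parents but one, d; it needs no free end if it contains a pair. This is so if it
-- contains the pair that w was put on, or if w met some parent c ≠ d alone, since then {c , w} is
-- a pair. Otherwise w has at most one G-neighbour among its parents, or k = 2 and w was put on a
-- pair, or k = 1; in all these cases w has enough free ends: those of its own interval if k ≤ 2,
-- those of further intervals of w, one graph each, if k ≥ 3.

-- Points of an interval graph and the vertices over them

On : ∀ {m} {G : Graph m} → IntervalSubgraph G → ℕ → Fin m → Set
On I p v = inV I v ≡ true × left I v ≤ p × p ≤ right I v

-- Division by 3, with `i` as the remainder: it turns inequalities between tripled coordinates back
-- into inequalities between the old points.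
*3-cancel-≤ : ∀ {a b i} → i ≤ 2 → a * 3 ≤ i + b * 3 → a ≤ b
*3-cancel-≤ {a} {b} {i} i≤2 a3≤ with a ≤? b
... | yes a≤b = a≤b
... | no a≰b = contradiction
  (≤-trans (*-monoˡ-≤ 3 (≰⇒> a≰b)) (≤-trans a3≤ (+-monoˡ-≤ (b * 3) i≤2))) (<-irrefl refl)

-- All that matters about a point is which vertices lie over it, so emptiness and bags travel along
-- this relation. This is how they survive when the line is stretched.
Copy : ∀ {m} {G : Graph m} → IntervalSubgraph G → IntervalSubgraph G → ℕ → ℕ → Set
Copy I J p q = ∀ v → (On I p v → On J q v) × (On J q v → On I p v)

Empty : ∀ {m} {G : Graph m} → IntervalSubgraph G → ℕ → Set
Empty I p = ∀ v → ¬ On I p v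

Bag₁ : ∀ {m} {G : Graph m} → IntervalSubgraph G → ℕ → Fin m → Set
Bag₁ I p c = On I p c × (∀ v → On I p v → v ≡ c)

Bag₂ : ∀ {m} {G : Graph m} → IntervalSubgraph G → ℕ → Fin m → Fin m → Set
Bag₂ I p a b = On I p a × On I p b × (∀ v → On I p v → v ≡ a ⊎ v ≡ b)

data Side : Set where
  before after : Side

-- A free end of `c`: an interval laid across the gap between `p` and `suc p` meets `c` only and
-- still reaches into an empty part.
End : ∀ {m} {G : Graph m} → Side → IntervalSubgraph G → ℕ → Fin m → Set
End before I p c = Empty I p × Bag₁ I (suc p) c
End after  I p c = Bag₁ I p c × Empty I (suc p)

module _ {m} {G : Graph m} (I J : IntervalSubgraph G) {p q : ℕ} (copy : Copy I J p q) where

  copy-empty : Empty I p → Empty J q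
  copy-empty e v o = e v (proj₂ (copy v) o)

  copy-bag₁ : ∀ {c} → Bag₁ I p c → Bag₁ J q c
  copy-bag₁ (o , u) = proj₁ (copy _) o , λ v o′ → u v (proj₂ (copy v) o′)

  copy-bag₂ : ∀ {a b} → Bag₂ I p a b → Bag₂ J q a b
  copy-bag₂ (o , o₂ , u) = proj₁ (copy _) o , proj₁ (copy _) o₂ , λ v o′ → u v (proj₂ (copy v) o′)

bag₂-swap : ∀ {m} {G : Graph m} {I : IntervalSubgraph G} {p a b} → Bag₂ I p a b → Bag₂ I p b a
bag₂-swap (o , o₂ , u) = o₂ , o , λ v o′ → [ inj₂ , inj₁ ]′ (u v o′)

end-tip : ∀ {m} {G : Graph m} {I : IntervalSubgraph G} s {p c} → End s I p c → ∃ λ q → Bag₁ I q c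
end-tip before (_ , b) = _ , b
end-tip after  (b , _) = _ , b

ends-differ : ∀ {m} {G : Graph m} {I : IntervalSubgraph G} {s s′ p c c′} →
              End s I p c → End s′ I p c′ → s ≡ s′
ends-differ {s = before} {before} _ _ = refl
ends-differ {s = after}  {after}  _ _ = refl
ends-differ {s = before} {after}  (e , _) ((o , _) , _) = contradiction o (e _)
ends-differ {s = after}  {before} ((o , _) , _) (e , _) = contradiction o (e _)

-- Inserting a vertex into an interval graph

module Insertion {m} {G : Graph m} (w : Fin m) where

  data Place (I : IntervalSubgraph G) : Set where
    at      : ∀ p → (∀ u → On I p u → adj G w u ≡ true) → Place I
    between : ∀ p → (∀ u → On I p u → adj G w u ≡ true) →
              (∀ u → On I (suc p) u → adj G w u ≡ true) → Place I

  -- The old point `p` has the copies `p * 3`, `1 + p * 3` and `2 + p * 3`. A place `at p` takes the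
  -- middle copy, a place `between` the last copy of `p` and the first copy of `suc p`.
  lo hi : ∀ {I} → Place I → ℕ
  lo (at p _)        = 1 + p * 3
  lo (between p _ _) = 2 + p * 3
  hi (at p _)        = 1 + p * 3
  hi (between p _ _) = 3 + p * 3

  lo≤hi : ∀ {I} (a : Place I) → lo a ≤ hi a
  lo≤hi (at p _)        = ≤-refl
  lo≤hi (between p _ _) = n≤1+n _

  place-adj : ∀ {I} (a : Place I) {u} → inV I u ≡ true →
              left I u * 3 ≤ hi a → lo a ≤ 2 + right I u * 3 → adj G w u ≡ true
  place-adj (at p A) u∈ l≤ ≤r =
    A _ (u∈ , *3-cancel-≤ (s≤s z≤n) l≤ , *3-cancel-≤ ≤-refl (≤-trans (n≤1+n _) ≤r))
  place-adj {I} (between p A B) {u} u∈ l≤ ≤r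
    with *3-cancel-≤ {left I u} {suc p} {0} z≤n l≤
       | *3-cancel-≤ {p} {right I u} ≤-refl (≤-trans (m≤n+m (p * 3) 2) ≤r)
  ... | l≤1+p | p≤r with left I u ≤? p
  ...   | yes l≤p = A u (u∈ , l≤p , p≤r)
  ...   | no  l≰p = B u (u∈ , l≤1+p , ≤-trans (≰⇒> l≰p) (nonempty I u))

  -- Each point of the line is tripled, which makes room for w inside a point
  -- (meeting just the intervals through it) or between two consecutive points.
  insert : (I : IntervalSubgraph G) → Place I → IntervalSubgraph G
  insert I a = record
    { inV      = λ v → if does (v ≟ w) then true else inV I v
    ; left     = ℓ
    ; right    = r
    ; nonempty = ne
    ; sub      = sb
    }
    where
    ℓ r : Fin m → ℕ
    ℓ v = if does (v ≟ w) then lo a else left I v * 3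
    r v = if does (v ≟ w) then hi a else 2 + right I v * 3
    ne : ∀ v → ℓ v ≤ r v
    ne v with v ≟ w
    ... | yes _ = lo≤hi a
    ... | no  _ = ≤-trans (*-monoˡ-≤ 3 (nonempty I v)) (m≤n+m _ 2)
    sb : ∀ u v → u ≢ v → (if does (u ≟ w) then true else inV I u) ≡ true →
         (if does (v ≟ w) then true else inV I v) ≡ true →
         ℓ u ≤ r v → ℓ v ≤ r u → adj G u v ≡ true
    sb u v u≢v u∈ v∈ p q with u ≟ w | v ≟ w
    ... | yes refl | yes refl = contradiction refl u≢v
    ... | yes refl | no  _    = place-adj a v∈ q p
    ... | no  _    | yes refl = trans (Graph.sym G u w) (place-adj a u∈ p q)
    ... | no  _    | no  _    =
      sub I u v u≢v u∈ v∈ (*3-cancel-≤ ≤-refl p) (*3-cancel-≤ ≤-refl q)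

  module _ {I : IntervalSubgraph G} (a : Place I) where

    insert-inV⁻ : ∀ {v} → inV (insert I a) v ≡ true → v ≡ w ⊎ inV I v ≡ true
    insert-inV⁻ {v} v∈ with v ≟ w
    ... | yes v≡w = inj₁ v≡w
    ... | no  _   = inj₂ v∈

    on-new : ∀ {q} → lo a ≤ q → q ≤ hi a → On (insert I a) q w
    on-new p q with w ≟ w
    ... | yes _   = refl , p , q
    ... | no  w≢w = contradiction refl w≢w

    on-new⁻ : ∀ {q} → On (insert I a) q w → lo a ≤ q × q ≤ hi a
    on-new⁻ o with w ≟ w
    ... | yes _   = proj₂ o
    ... | no  w≢w = contradiction refl w≢w

    on-old : ∀ {i q v} → i ≤ 2 → v ≢ w → On I q v → On (insert I a) (i + q * 3) v
    on-old {i} {v = v} i≤2 v≢w (v∈ , l , r) with v ≟ w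
    ... | yes v≡w = contradiction v≡w v≢w
    ... | no  _   = v∈ , ≤-trans (*-monoˡ-≤ 3 l) (m≤n+m _ i) , +-mono-≤ i≤2 (*-monoˡ-≤ 3 r)

    on-old⁻ : ∀ {i q v} → i ≤ 2 → v ≢ w → On (insert I a) (i + q * 3) v → On I q v
    on-old⁻ {i} {v = v} i≤2 v≢w (v∈ , l , r) with v ≟ w
    ... | yes v≡w = contradiction v≡w v≢w
    ... | no  _   = v∈ , *3-cancel-≤ i≤2 l , *3-cancel-≤ ≤-refl (≤-trans (m≤n+m _ i) r)


    on-split : ∀ {i q v} → i ≤ 2 → On (insert I a) (i + q * 3) v → v ≡ w ⊎ On I q v
    on-split {v = v} i≤2 o = case v ≟ w of λ where
      (yes v≡w) → inj₁ v≡w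
      (no  v≢w) → inj₂ (on-old⁻ i≤2 v≢w o)

    module _ (w∉ : ¬ inV I w ≡ true) where

      on⇒≢ : ∀ {q v} → On I q v → v ≢ w
      on⇒≢ (v∈ , _) refl = w∉ v∈

      copy : ∀ {i q} → i ≤ 2 → ¬ (lo a ≤ i + q * 3 × i + q * 3 ≤ hi a) →
             Copy I (insert I a) q (i + q * 3)
      copy {i} {q} i≤2 miss v = (λ o → on-old i≤2 (on⇒≢ o) o) , bwd
        where
        bwd : On (insert I a) (i + q * 3) v → On I q v
        bwd o with on-split i≤2 o
        ... | inj₁ refl = contradiction (on-new⁻ o) miss
        ... | inj₂ o′   = o′

      -- The new interval covers at most one of the three copies of a point, so every bag that
      -- existed before still exists somewhere.
      insert-copy : ∀ q → ∃ λ q′ → Copy I (insert I a) q q′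
      insert-copy q = shift a refl
        where
        -- p * 3 is excluded for a single inserted point, 1 + p * 3 for two.
        shift : ∀ a′ → a ≡ a′ → ∃ λ q′ → Copy I (insert I a) q q′
        shift (at p _) refl = 0 + q * 3 , copy z≤n (λ (l , h) →
          <⇒≱ l (*-monoˡ-≤ 3 (*3-cancel-≤ {q} {p} (s≤s z≤n) h)))
        shift (between p _ _) refl = 1 + q * 3 , copy (s≤s z≤n) (λ { (s≤s l , s≤s h) →
          <⇒≱ l (*-monoˡ-≤ 3 (*3-cancel-≤ {q} {p} ≤-refl h)) })

      Misses : ℕ → Set
      Misses r = ∀ {p A B} → a ≡ between p A B → p ≢ r

      -- The end moves to the last copy of `r` and the first copy of `suc r`. A place `at` covers
      -- middle copies only, and a place `between` covers these two only if it straddles the same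
      -- gap.
      insert-end : ∀ {s r c} → Misses r → End s I r c → End s (insert I a) (2 + r * 3) c
      insert-end {s} {r} miss e = move s e
        where
        out₁ : ¬ (lo a ≤ 2 + r * 3 × 2 + r * 3 ≤ hi a)
        out₁ = go a refl
          where
          go : ∀ a′ → a ≡ a′ → ¬ (lo a′ ≤ 2 + r * 3 × 2 + r * 3 ≤ hi a′)
          go (at p _) _ (s≤s l , s≤s h) = <⇒≱ h (*-monoˡ-≤ 3 (*3-cancel-≤ {p} {r} (s≤s z≤n) l))
          go (between p _ _) eq (s≤s (s≤s l) , s≤s (s≤s h)) =
            miss eq (≤-antisym (*3-cancel-≤ {i = 0} z≤n l) (*3-cancel-≤ (s≤s z≤n) h))
        out₂ : ¬ (lo a ≤ 0 + suc r * 3 × 0 + suc r * 3 ≤ hi a)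
        out₂ = go a refl
          where
          go : ∀ a′ → a ≡ a′ → ¬ (lo a′ ≤ 3 + r * 3 × 3 + r * 3 ≤ hi a′)
          go (at p _) _ (s≤s l , s≤s h) =
            <⇒≱ (≤-trans (n≤1+n _) h) (*-monoˡ-≤ 3 (*3-cancel-≤ {p} {r} ≤-refl l))
          go (between p _ _) eq (s≤s (s≤s l) , s≤s (s≤s (s≤s h))) =
            miss eq (≤-antisym (*3-cancel-≤ (s≤s z≤n) l) (*3-cancel-≤ {i = 0} z≤n h))
        c₁ : Copy I (insert I a) r (2 + r * 3)
        c₁ = copy ≤-refl out₁
        c₂ : Copy I (insert I a) (suc r) (3 + r * 3)
        c₂ = copy z≤n out₂
        move : ∀ s {c} → End s I r c → End s (insert I a) (2 + r * 3) c
        move before (e , b) = copy-empty I (insert I a) c₁ e , copy-bag₁ I (insert I a) c₂ b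
        move after  (b , e) = copy-bag₁ I (insert I a) c₁ b , copy-empty I (insert I a) c₂ e

    insert-bag₁ : ∀ {i q} → i ≤ 2 → lo a ≤ i + q * 3 → i + q * 3 ≤ hi a → Empty I q →
                  Bag₁ (insert I a) (i + q * 3) w
    insert-bag₁ i≤2 l h e = on-new l h , λ v o →
      [ id , (λ o′ → contradiction o′ (e v)) ]′ (on-split i≤2 o)

    insert-empty : ∀ {i q} → i ≤ 2 → ¬ (lo a ≤ i + q * 3 × i + q * 3 ≤ hi a) → Empty I q →
                   Empty (insert I a) (i + q * 3)
    insert-empty i≤2 miss e v o =
      [ (λ { refl → miss (on-new⁻ o) }) , e v ]′ (on-split i≤2 o)

    insert-bag₂ : ∀ {i q c} → i ≤ 2 → lo a ≤ i + q * 3 → i + q * 3 ≤ hi a → c ≢ w → Bag₁ I q c →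
                  Bag₂ (insert I a) (i + q * 3) c w
    insert-bag₂ i≤2 l h c≢w (o , u) = on-old i≤2 c≢w o , on-new l h , λ v o′ →
      [ inj₂ , inj₁ ∘ u v ]′ (on-split i≤2 o′)

  -- Of the three copies of an empty point the middle one now carries `w` and the outer two stay
  -- empty, so both ends of `w` are free.
  insert-ends : ∀ {I p A} s → Empty I p → ∃ λ q → End s (insert I (at p A)) q w
  insert-ends {I} {p} {A} before e = 0 + p * 3 ,
    insert-empty {I} (at p A) {0} {p} z≤n (λ (l , _) → <-irrefl refl l) e ,
    insert-bag₁ {I} (at p A) {1} {p} (s≤s z≤n) ≤-refl ≤-refl e
  insert-ends {I} {p} {A} after  e = 1 + p * 3 ,
    insert-bag₁ {I} (at p A) {1} {p} (s≤s z≤n) ≤-refl ≤-refl e ,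
    insert-empty {I} (at p A) {2} {p} ≤-refl (λ (_ , h) → <-irrefl refl h) e

  -- The half of `w` on the side of `c` lies over `c` alone and creates a pair.
  extend-bag₂ : ∀ {I p A B c} s → c ≢ w → End s I p c →
                ∃ λ q → Bag₂ (insert I (between p A B)) q c w
  extend-bag₂ {I} {p = p} {A} {B} before c≢w (_ , b) =
    _ , insert-bag₂ {I} (between p A B) {0} {suc p} z≤n (n≤1+n _) ≤-refl c≢w b
  extend-bag₂ {I} {p = p} {A} {B} after  c≢w (b , _) =
    _ , insert-bag₂ {I} (between p A B) {2} {p} ≤-refl ≤-refl (n≤1+n _) c≢w b

  -- The other half lies over an empty point, so `w` inherits a free end on the same side.
  extend-end : ∀ {I p A B c} s → End s I p c → ∃ λ q → End s (insert I (between p A B)) q w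
  extend-end {I} {p = p} {A} {B} before (e , _) = 1 + p * 3 ,
    insert-empty {I} (between p A B) {1} {p} (s≤s z≤n) (λ (l , _) → <-irrefl refl l) e ,
    insert-bag₁ {I} (between p A B) {2} {p} ≤-refl ≤-refl (n≤1+n _) e
  extend-end {I} {p = p} {A} {B} after (_ , e) = 3 + p * 3 ,
    insert-bag₁ {I} (between p A B) {0} {suc p} z≤n (n≤1+n _) ≤-refl e ,
    insert-empty {I} (between p A B) {1} {suc p} (s≤s z≤n) (λ (_ , h) → <-irrefl refl h) e

-- Counting with lists and subsets

pigeonhole : ∀ {A : Set} (_≟A_ : (x y : A) → Dec (x ≡ y)) {xs ys : List A} → Unique xs →
             (∀ {x} → x L.∈ xs → x L.∈ ys) → length xs ≤ length ys
pigeonhole _≟A_ {[]} _ _ = z≤n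
pigeonhole _≟A_ {x ∷ xs} {ys} (x∉ ∷ u) sub = ≤-trans
  (s≤s (pigeonhole _≟A_ u λ y∈ →
    L.∈-filter⁺ ≢x? (sub (there y∈)) (λ { refl → All.lookup x∉ y∈ refl })))
  (filter-notAll ≢x? ys (Any.map (λ { refl ≢x → ≢x refl }) (sub (here refl))))
  where
  ≢x? : ∀ y → Dec (y ≢ x)
  ≢x? y = ¬? (y ≟A x)

remove : ∀ {n} → Fin n → List (Fin n) → List (Fin n)
remove x = filter (λ y → ¬? (y ≟ x))

∈-remove⁺ : ∀ {n} {x y : Fin n} {xs} → y L.∈ xs → y ≢ x → y L.∈ remove x xs
∈-remove⁺ = L.∈-filter⁺ _

∈-remove⁻ : ∀ {n} {x y : Fin n} {xs} → y L.∈ remove x xs → y L.∈ xs × y ≢ x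
∈-remove⁻ {x = x} = L.∈-filter⁻ (λ y → ¬? (y ≟ x))

length-remove : ∀ {n} {x : Fin n} {xs} → x L.∈ xs → length (remove x xs) < length xs
length-remove {xs = xs} x∈ = filter-notAll _ xs (Any.map (λ { refl ≢x → ≢x refl }) x∈)

elems : ∀ {n} → Subset n → List (Fin n)
elems []            = []
elems (inside ∷ p)  = zero ∷ map suc (elems p)
elems (outside ∷ p) = map suc (elems p)

∈-elems⁺ : ∀ {n} {p : Subset n} {x} → x ∈ p → x L.∈ elems p
∈-elems⁺ {p = inside ∷ p}  here       = here refl
∈-elems⁺ {p = inside ∷ p}  (there x∈) = there (L.∈-map⁺ suc (∈-elems⁺ x∈))
∈-elems⁺ {p = outside ∷ p} (there x∈) = L.∈-map⁺ suc (∈-elems⁺ x∈)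

∈-elems⁻ : ∀ {n} (p : Subset n) {x} → x L.∈ elems p → x ∈ p
∈-elems⁻ (inside ∷ p)  (here refl) = here
∈-elems⁻ (inside ∷ p)  (there x∈) with _ , y∈ , refl ← L.∈-map⁻ suc x∈ = there (∈-elems⁻ p y∈)
∈-elems⁻ (outside ∷ p) x∈         with _ , y∈ , refl ← L.∈-map⁻ suc x∈ = there (∈-elems⁻ p y∈)

elems-unique : ∀ {n} (p : Subset n) → Unique (elems p)
elems-unique []            = []
elems-unique (inside ∷ p)  =
  All.tabulate (λ x∈ → λ { refl → case L.∈-map⁻ suc x∈ of λ () }) ∷
  Unique.map⁺ (λ { refl → refl }) (elems-unique p)
elems-unique (outside ∷ p) = Unique.map⁺ (λ { refl → refl }) (elems-unique p)

length-elems : ∀ {n} (p : Subset n) → length (elems p) ≡ ∣ p ∣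
length-elems []            = refl
length-elems (inside ∷ p)  = cong suc (trans (length-map suc (elems p)) (length-elems p))
length-elems (outside ∷ p) = trans (length-map suc (elems p)) (length-elems p)

∣_∣≤length : ∀ {n} (p : Subset n) {ys} → (∀ {x} → x ∈ p → x L.∈ ys) → ∣ p ∣ ≤ length ys
∣ p ∣≤length {ys} sub = subst (_≤ length ys) (length-elems p)
  (pigeonhole _≟_ (elems-unique p) (sub ∘ ∈-elems⁻ p))

length≤∣_∣ : ∀ {n} (p : Subset n) {xs} → Unique xs → (∀ {x} → x L.∈ xs → x ∈ p) → length xs ≤ ∣ p ∣
length≤∣ p ∣ {xs} u sub = subst (length xs ≤_) (length-elems p) (pigeonhole _≟_ u (∈-elems⁺ ∘ sub))

element-outside : ∀ {n} (p : Subset n) xs → length xs < ∣ p ∣ → ∃ λ c → c ∈ p × ¬ c L.∈ xs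
element-outside {n} p xs short with any? (λ c → c ∈? p ×-dec ¬? (DecMembership._∈?_ _≟_ c xs))
... | yes found = found
... | no none   = contradiction (∣ p ∣≤length covered) (<⇒≱ short)
  where
  covered : ∀ {x} → x ∈ p → x L.∈ xs
  covered {x} x∈ with DecMembership._∈?_ _≟_ x xs
  ... | yes x∈xs = x∈xs
  ... | no  x∉xs = contradiction (x , x∈ , x∉xs) none

∣initial-segment∣ : ∀ {n} (p : Subset n) t → t ≤ n → (∀ i → i ∈ p → toℕ i < t) →
                    (∀ i → toℕ i < t → i ∈ p) → ∣ p ∣ ≡ t
∣initial-segment∣ []            zero    _         _   _   = refl
∣initial-segment∣ (inside ∷ p)  zero    _         sub _   = case sub zero here of λ ()
∣initial-segment∣ (outside ∷ p) zero    _         sub _   =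
  ∣initial-segment∣ p zero z≤n (λ i i∈ → case sub (suc i) (there i∈) of λ ()) (λ _ ())
∣initial-segment∣ (inside ∷ p)  (suc t) (s≤s t≤n) sub sup =
  cong suc (∣initial-segment∣ p t t≤n (λ i i∈ → ≤-pred (sub (suc i) (there i∈)))
    (λ i i<t → drop-there (sup (suc i) (s≤s i<t))))
∣initial-segment∣ (outside ∷ p) (suc t) _         _   sup = case sup zero (s≤s z≤n) of λ ()

-- Cliques of a simple k-tree

module Tree {k m} (T : SimpleKTree k m) where

  P : Fin m → Subset m
  P = parents T

  below : ∀ {i j} → i ∈ P j → toℕ i < toℕ j
  below {i} {j} i∈ with toℕ j ≤? k
  ... | yes j≤k = initial-sub T j i j≤k i∈
  ... | no  j≰k = later-below T j i (≰⇒> j≰k) i∈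

  clique : ∀ {a b j} → a ∈ P j → b ∈ P j → toℕ a < toℕ b → a ∈ P b
  clique {a} {b} {j} a∈ b∈ a<b with toℕ j ≤? k
  ... | yes j≤k = initial-sup T b a (<⇒≤ (<-≤-trans (below b∈) j≤k)) a<b
  ... | no  j≰k = later-clique T j a b (≰⇒> j≰k) a∈ b∈ a<b

  size-initial : ∀ {j} → toℕ j ≤ k → ∣ P j ∣ ≡ toℕ j
  size-initial {j} j≤k = ∣initial-segment∣ (P j) (toℕ j) (<⇒≤ (toℕ<n j))
    (λ i → below) (λ i → initial-sup T j i j≤k)

  -- The bound is not strict: vertex `k` is treated like the later ones, as attached to the clique
  -- of the first `k` vertices.
  size : ∀ {j} → k ≤ toℕ j → ∣ P j ∣ ≡ k
  size {j} k≤j with toℕ j ≤? k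
  ... | yes j≤k = trans (size-initial j≤k) (≤-antisym j≤k k≤j)
  ... | no  j≰k = later-size T j (≰⇒> j≰k)

  comparable : ∀ {a b j} → a ∈ P j → b ∈ P j → a ≢ b → a ∈ P b ⊎ b ∈ P a
  comparable {a} {b} a∈ b∈ a≢b with <-cmp (toℕ a) (toℕ b)
  ... | tri< a<b _ _ = inj₁ (clique a∈ b∈ a<b)
  ... | tri≈ _ eq _  = contradiction (toℕ-injective eq) a≢b
  ... | tri> _ _ b<a = inj₂ (clique b∈ a∈ b<a)

  -- j is attached to a clique whose youngest vertex is w.
  record New (w j : Fin m) : Set where
    field
      late     : k ≤ toℕ j
      contains : w ∈ P j
      youngest : ∀ {a} → a ∈ P j → toℕ a ≤ toℕ w

    parent-split : ∀ {a} → a ∈ P j → a ≢ w → a ∈ P w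
    parent-split a∈ a≢w = clique a∈ contains (≤∧≢⇒< (youngest a∈) (a≢w ∘ toℕ-injective))

    ⊆-cons : ∀ {a} → a ∈ P j → a L.∈ w ∷ elems (P w)
    ⊆-cons {a} a∈ with a ≟ w
    ... | yes refl = here refl
    ... | no  a≢w  = there (∈-elems⁺ (parent-split a∈ a≢w))

  open New public

  private variable
    w j j′ c d : Fin m

  -- Both parent sets have `k` elements, and `w` lies in `P j` but not in `P w`.
  missing : k ≤ toℕ w → New w j → ∃ λ d → d ∈ P w × d ∉ P j
  missing {w} {j} k≤w new with any? (λ d → d ∈? P w ×-dec ¬? (d ∈? P j))
  ... | yes found = found
  ... | no  none  = contradiction (p⊂q⇒∣p∣<∣q∣ (incl , w , contains new , λ w∈ → <-irrefl refl (below w∈)))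
                      (<-irrefl (trans (size k≤w) (sym (size (late new)))))
    where
    incl : P w ⊆ P j
    incl {d} d∈ with d ∈? P j
    ... | yes d∈j = d∈j
    ... | no  d∉j = contradiction (d , d∈ , d∉j) none

  -- `P j` consists of `w` and parents of `w`; with two of the `k` parents absent, fewer than `k`
  -- vertices would be left.
  present : k ≤ toℕ w → New w j → d ∈ P w → d ∉ P j → c ∈ P w → c ≢ d → c ∈ P j
  present {w} {j} {d} {c} k≤w new d∈ d∉ c∈ c≢d with c ∈? P j
  ... | yes c∈j = c∈j
  ... | no  c∉j = contradiction too-few (<-irrefl refl)
    where
    rest : List (Fin m)
    rest = remove c (remove d (elems (P w)))
    cover : ∀ {a} → a ∈ P j → a L.∈ w ∷ rest
    cover a∈ with ⊆-cons new a∈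
    ... | here refl = here refl
    ... | there a∈w = there (∈-remove⁺ (∈-remove⁺ a∈w λ { refl → d∉ a∈ }) λ { refl → c∉j a∈ })
    too-few : k < k
    too-few = begin-strict
      k                              ≡⟨ size (late new) ⟨
      ∣ P j ∣                        ≤⟨ ∣ P j ∣≤length cover ⟩
      suc (length rest)              ≤⟨ length-remove (∈-remove⁺ (∈-elems⁺ c∈) c≢d) ⟩
      length (remove d (elems (P w))) <⟨ length-remove (∈-elems⁺ d∈) ⟩
      length (elems (P w))           ≡⟨ length-elems (P w) ⟩
      ∣ P w ∣                        ≡⟨ size k≤w ⟩
      k                              ∎
      where open ≤-Reasoning

  -- The clique is `w` together with `P w` minus `d`, and no clique is used twice. Being above `w`,
  -- both vertices come after vertex `k`, where `later-simple` applies.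
  missing-determines : k ≤ toℕ w → toℕ w < toℕ j → toℕ w < toℕ j′ → New w j → New w j′ →
                       d ∈ P w → d ∉ P j → d ∉ P j′ → j ≡ j′
  missing-determines {w} {j} {j′} {d} k≤w w<j w<j′ n n′ d∈ d∉ d∉′ =
    later-simple T j j′ (≤-<-trans k≤w w<j) (≤-<-trans k≤w w<j′)
      (⊆-antisym (half n n′ d∉ d∉′) (half n′ n d∉′ d∉))
    where
    half : ∀ {j j′} → New w j → New w j′ → d ∉ P j → d ∉ P j′ → P j ⊆ P j′
    half n n′ d∉ d∉′ {a} a∈ with a ≟ w
    ... | yes refl = contains n′
    ... | no  a≢w  = present k≤w n′ d∈ d∉′ (parent-split n a∈ a≢w) λ { refl → d∉ a∈ }

  -- Here `w` has only `toℕ w < k` parents, so together with `w` they are just enough to fill the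
  -- `k` places of `P j`, if at all.
  initial-parents : toℕ w < k → New w j → c ∈ P w → c ∈ P j
  initial-parents {w} {j} {c} w<k new c∈ with c ∈? P j
  ... | yes c∈j = c∈j
  ... | no  c∉j = contradiction w<k (≤⇒≯ too-few)
    where
    cover : ∀ {a} → a ∈ P j → a L.∈ w ∷ remove c (elems (P w))
    cover a∈ with ⊆-cons new a∈
    ... | here refl = here refl
    ... | there a∈w = there (∈-remove⁺ a∈w λ { refl → c∉j a∈ })
    too-few : k ≤ toℕ w
    too-few = begin
      k                                      ≡⟨ size (late new) ⟨
      ∣ P j ∣                                ≤⟨ ∣ P j ∣≤length cover ⟩
      suc (length (remove c (elems (P w)))) ≤⟨ length-remove (∈-elems⁺ c∈) ⟩
      length (elems (P w))                   ≡⟨ length-elems (P w) ⟩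
      ∣ P w ∣                                ≡⟨ size-initial (<⇒≤ w<k) ⟩
      toℕ w                                  ∎
      where open ≤-Reasoning

  initial-same : toℕ w < k → New w j → New w j′ → P j ≡ P j′
  initial-same {w} w<k n n′ = ⊆-antisym (half n n′) (half n′ n)
    where
    half : ∀ {j j′} → New w j → New w j′ → P j ⊆ P j′
    half n n′ {a} a∈ with a ≟ w
    ... | yes refl = contains n′
    ... | no  a≢w  = initial-parents w<k n′ (parent-split n a∈ a≢w)

-- The invariant of the vertex-by-vertex construction

module Construction {k m} (T : SimpleKTree k m) (G : Graph m)
                    (tree : ∀ u v → adj G u v ≡ true → TreeAdj T u v) where
  open Tree T

  -- The interval graphs are indexed by pairs of vertices; (w , y) is only used
  -- from the moment w is processed on.
  Key : Set
  Key = Fin m × Fin m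

  _≟K_ : (κ κ′ : Key) → Dec (κ ≡ κ′)
  _≟K_ = ≡-dec _≟_ _≟_

  Family : Set
  Family = Key → IntervalSubgraph G

  -- For these vertices a pair or a token is promised: the step of the youngest parent has to
  -- provide it, and later steps have to preserve it.
  Ready : ℕ → Fin m → Set
  Ready t j = k ≤ toℕ j × t ≤ toℕ j × (∀ a → a ∈ P j → toℕ a < t)

  HasPair : Family → (Fin m → Key) → Fin m → Set
  HasPair fam host j = ∃₂ λ a b → a ∈ P j × b ∈ P j × a ≢ b × ∃ λ p → Bag₂ (fam (host a)) p a b

  record HasToken (fam : Family) (host : Fin m → Key) (own : Fin m → Key → Side → Set)
                  (j : Fin m) : Set where
    field
      key    : Key
      side   : Side
      vertex : Fin m
      point  : ℕ
      parent : vertex ∈ P j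
      owned  : own j key side
      tip    : End side (fam key) point vertex
      -- When `j` uses the token, `key` becomes its host. For `k ≥ 3` the hosts of adjacent vertices
      -- have to stay distinct, so then no parent may be hosted there.
      apart  : ∀ d → d ∈ P j → host d ≡ key → d ≡ vertex × k ≤ 2

  -- The situation when the vertices below t are processed. A new vertex j is
  -- adjacent to k earlier ones and also needs a graph of its own, so it has to
  -- meet two parents at once, or to share its own graph with a parent: this
  -- is what a pair, respectively a token reserved for j, is good for.
  record State (t : ℕ) : Set₁ where
    field
      fam       : Family
      host      : Fin m → Key
      own       : Fin m → Key → Side → Set
      fresh     : ∀ {x y v} → t ≤ toℕ x → ¬ inV (fam (x , y)) v ≡ true
      old       : ∀ {κ v} → inV (fam κ) v ≡ true → toℕ v < t
      cover     : ∀ {u v} → u ∈ P v → toℕ v < t → adj G v u ≡ true →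
                  ∃₂ λ κ p → On (fam κ) p v × On (fam κ) p u
      bag       : ∀ v → toℕ v < t → ∃ λ p → Bag₁ (fam (host v)) p v
      -- A vertex has one interval per graph, so it can enter the hosts of several neighbours
      -- separately only if these hosts differ.
      separate  : ∀ {a b} → a ∈ P b → toℕ b < t → host a ≡ host b → k ≤ 2
      few       : ∀ v → toℕ v < t →
                  ∃ λ κs → length κs ≤ k × (∀ κ → inV (fam κ) v ≡ true → κ L.∈ κs)
      supply    : ∀ j → Ready t j → HasPair fam host j ⊎ HasToken fam host own j
      own-old   : ∀ {j x y s} → own j (x , y) s → toℕ x < t
      exclusive : ∀ {j j′ κ s} → Ready t j → Ready t j′ → own j κ s → own j′ κ s → j ≡ j′

  -- Processing one vertex: plans and how they preserve the invariant

  module Step (w : Fin m) (S : State (toℕ w)) where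
    open State S
    open Insertion {G = G} w

    Entry : Set
    Entry = Σ Key λ κ → Place (fam κ)

    step : List Entry → Family
    step []             κ = fam κ
    step ((κ′ , a) ∷ L) κ with κ′ ≟K κ
    ... | yes refl = insert (fam κ) a
    ... | no  _    = step L κ

    step-cases : ∀ L κ → (step L κ ≡ fam κ × (∀ a → ¬ (κ , a) L.∈ L)) ⊎
                 (∃ λ a → (κ , a) L.∈ L × step L κ ≡ insert (fam κ) a)
    step-cases []             κ = inj₁ (refl , λ _ ())
    step-cases ((κ′ , a) ∷ L) κ with κ′ ≟K κ
    ... | yes refl = inj₂ (a , here refl , refl)
    ... | no  κ′≢κ with step-cases L κ
    ...   | inj₁ (eq , none)   = inj₁ (eq , λ { a (here refl) → κ′≢κ refl ; a (there a∈) → none a a∈ })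
    ...   | inj₂ (a , a∈ , eq) = inj₂ (a , there a∈ , eq)

    -- All entries with the key of `e` have to be examined, since any of them might be the one that
    -- takes effect.
    step-elim : ∀ (Q : IntervalSubgraph G → Set) L {e} → e L.∈ L →
                (∀ e′ → e′ L.∈ L → proj₁ e′ ≡ proj₁ e → Q (insert (fam (proj₁ e′)) (proj₂ e′))) →
                Q (step L (proj₁ e))
    step-elim Q L {κ , _} e∈ q with step-cases L κ
    ... | inj₁ (_ , none)      = contradiction e∈ (none _)
    ... | inj₂ (a , a∈ , eq) = subst Q (sym eq) (q (κ , a) a∈ refl)

    w∉ : ∀ κ → ¬ inV (fam κ) w ≡ true
    w∉ κ w∈ = <-irrefl refl (old w∈)

    module _ (L : List Entry) where

      step-copy : ∀ κ q → ∃ λ q′ → Copy (fam κ) (step L κ) q q′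
      step-copy κ q with step-cases L κ
      ... | inj₁ (eq , _)     rewrite eq = q , λ v → id , id
      ... | inj₂ (a , _ , eq) rewrite eq = insert-copy a (w∉ κ) q

      step-bag₁ : ∀ κ {q c} → Bag₁ (fam κ) q c → ∃ λ q′ → Bag₁ (step L κ) q′ c
      step-bag₁ κ {q} b with q′ , cp ← step-copy κ q = q′ , copy-bag₁ (fam κ) (step L κ) cp b

      step-bag₂ : ∀ κ {q a b} → Bag₂ (fam κ) q a b → ∃ λ q′ → Bag₂ (step L κ) q′ a b
      step-bag₂ κ {q} b with q′ , cp ← step-copy κ q = q′ , copy-bag₂ (fam κ) (step L κ) cp b

      step-end : ∀ κ {s r c} → (∀ {p A B} → (κ , between p A B) L.∈ L → p ≢ r) →
                 End s (fam κ) r c → ∃ λ r′ → End s (step L κ) r′ c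
      step-end κ {s} {r} miss e with step-cases L κ
      ... | inj₁ (eq , _)      rewrite eq = r , e
      ... | inj₂ (a , a∈ , eq) rewrite eq =
        _ , insert-end a (w∉ κ) {s} (λ { refl → miss a∈ }) e

      step-inV⁻ : ∀ {κ v} → inV (step L κ) v ≡ true →
                  (v ≡ w × ∃ λ a → (κ , a) L.∈ L) ⊎ inV (fam κ) v ≡ true
      step-inV⁻ {κ} v∈ with step-cases L κ
      ... | inj₁ (eq , _)      rewrite eq = inj₂ v∈
      ... | inj₂ (a , a∈ , eq) rewrite eq with insert-inV⁻ a v∈
      ...   | inj₁ v≡w = inj₁ (v≡w , a , a∈)
      ...   | inj₂ v∈′ = inj₂ v∈′

    update : Key → Fin m → Key
    update h v = if does (v ≟ w) then h else host v

    update-new : ∀ {h} → update h w ≡ h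
    update-new with w ≟ w
    ... | yes _   = refl
    ... | no  w≢w = contradiction refl w≢w

    update-old : ∀ {h v} → v ≢ w → update h v ≡ host v
    update-old {v = v} v≢w with v ≟ w
    ... | yes v≡w = contradiction v≡w v≢w
    ... | no  _   = refl

    <⇒≢w : ∀ {v} → toℕ v < toℕ w → v ≢ w
    <⇒≢w v<w refl = <-irrefl refl v<w

    -- The choices for `w` and the facts special to them. The rest of the invariant follows in
    -- `advance`, mostly by copying points.
    record Plan : Set₁ where
      field
        entries    : List Entry
        host-w     : Key
        label      : Fin m → Key → Side → Set
        keys       : ∀ {x y a} → ((x , y) , a) L.∈ entries → toℕ x ≤ toℕ w
        short      : length entries ≤ k
        bag-w      : ∃ λ p → Bag₁ (step entries host-w) p w
        cover-w    : ∀ {c} → c ∈ P w → adj G w c ≡ true →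
                     ∃₂ λ κ p → On (step entries κ) p w × On (step entries κ) p c
        separate-w : ∀ {a} → a ∈ P w → host a ≡ host-w → k ≤ 2
        -- Only a place `between` can destroy a free end, and this must not be an end reserved for
        -- another waiting vertex.
        harmless   : ∀ {κ p A B j s c r} → (κ , between p A B) L.∈ entries → Ready (toℕ w) j →
                     j ≢ w → own j κ s → End s (fam κ) r c → p ≢ r
        label-old  : ∀ {j x y s} → label j (x , y) s → toℕ x ≤ toℕ w
        label-inj  : ∀ {j j′ κ s} → toℕ w < toℕ j → toℕ w < toℕ j′ → New w j → New w j′ →
                     label j κ s → label j′ κ s → j ≡ j′
        label-new  : ∀ {j j′ κ s} → Ready (toℕ w) j′ → j′ ≢ w → label j κ s → ¬ own j′ κ s
        supply-new : ∀ {j} → toℕ w < toℕ j → New w j →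
                     HasPair (step entries) (update host-w) j ⊎
                     HasToken (step entries) (update host-w) label j

    advance : Plan → State (suc (toℕ w))
    advance plan = record
      { fam       = fam′
      ; host      = host′
      ; own       = own′
      ; fresh     = fresh′
      ; old       = old′
      ; cover     = cover′
      ; bag       = bag′
      ; separate  = separate′
      ; few       = few′
      ; supply    = supply′
      ; own-old   = λ { (inj₁ (_ , l)) → s≤s (label-old l) ; (inj₂ (_ , o)) → m<n⇒m<1+n (own-old o) }
      ; exclusive = exclusive′
      }
      where
      open Plan plan
      fam′ : Family
      fam′ = step entries
      host′ : Fin m → Key
      host′ = update host-w
      own′ : Fin m → Key → Side → Set
      -- Ends are newly assigned to vertices whose clique contains `w`; all other vertices keep
      -- their reservations.
      own′ j κ s = (w ∈ P j × label j κ s) ⊎ (w ∉ P j × own j κ s)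

      fresh′ : ∀ {x y v} → suc (toℕ w) ≤ toℕ x → ¬ inV (fam′ (x , y)) v ≡ true
      fresh′ w<x v∈ with step-inV⁻ entries v∈
      ... | inj₁ (_ , a , a∈) = <⇒≱ w<x (keys a∈)
      ... | inj₂ v∈′         = fresh (<⇒≤ w<x) v∈′

      old′ : ∀ {κ v} → inV (fam′ κ) v ≡ true → toℕ v < suc (toℕ w)
      old′ v∈ with step-inV⁻ entries v∈
      ... | inj₁ (refl , _) = ≤-refl
      ... | inj₂ v∈′        = m<n⇒m<1+n (old v∈′)

      earlier : ∀ {v} → toℕ v < suc (toℕ w) → v ≢ w → toℕ v < toℕ w
      earlier (s≤s v≤w) v≢w = ≤∧≢⇒< v≤w (v≢w ∘ toℕ-injective)

      cover′ : ∀ {u v} → u ∈ P v → toℕ v < suc (toℕ w) → adj G v u ≡ true →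
               ∃₂ λ κ p → On (fam′ κ) p v × On (fam′ κ) p u
      cover′ {u} {v} u∈ v≤w e with v ≟ w
      ... | yes refl = cover-w u∈ e
      ... | no  v≢w with κ , p , ov , ou ← cover u∈ (earlier v≤w v≢w) e
                    with q , cp ← step-copy entries κ p =
        κ , q , proj₁ (cp v) ov , proj₁ (cp u) ou

      bag′ : ∀ v → toℕ v < suc (toℕ w) → ∃ λ p → Bag₁ (fam′ (host′ v)) p v
      bag′ v v≤w with v ≟ w
      ... | yes refl = bag-w
      ... | no  v≢w  = step-bag₁ entries (host v) (proj₂ (bag v (earlier v≤w v≢w)))

      separate′ : ∀ {a b} → a ∈ P b → toℕ b < suc (toℕ w) → host′ a ≡ host′ b → k ≤ 2
      separate′ {a} {b} a∈ b≤w eq with b ≟ w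
      ... | yes refl = separate-w a∈ (trans (sym (update-old (<⇒≢w (below a∈)))) eq)
      ... | no  b≢w  = separate a∈ b<w (trans (sym (update-old (<⇒≢w (<-trans (below a∈) b<w)))) eq)
        where b<w = earlier b≤w b≢w

      few′ : ∀ v → toℕ v < suc (toℕ w) →
             ∃ λ κs → length κs ≤ k × (∀ κ → inV (fam′ κ) v ≡ true → κ L.∈ κs)
      few′ v v≤w with v ≟ w
      ... | yes refl = map proj₁ entries , subst (_≤ k) (sym (length-map proj₁ entries)) short , mem
        where
        mem : ∀ κ → inV (fam′ κ) w ≡ true → κ L.∈ map proj₁ entries
        mem κ v∈ with step-inV⁻ entries v∈
        ... | inj₁ (_ , a , a∈) = L.∈-map⁺ proj₁ a∈
        ... | inj₂ v∈′         = contradiction v∈′ (w∉ κ)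
      ... | no v≢w with κs , κs≤k , mem ← few v (earlier v≤w v≢w) = κs , κs≤k , λ κ v∈ →
        [ (λ (v≡w , _) → contradiction v≡w v≢w) , mem κ ]′ (step-inV⁻ entries v∈)

      new : ∀ {j} → Ready (suc (toℕ w)) j → w ∈ P j → New w j
      new (k≤j , w<j , par) w∈ = record
        { late = k≤j ; contains = w∈ ; youngest = λ {a} a∈ → ≤-pred (par a a∈) }

      ready : ∀ {j} → Ready (suc (toℕ w)) j → w ∉ P j → Ready (toℕ w) j
      ready (k≤j , w<j , par) w∉j =
        k≤j , <⇒≤ w<j , λ a a∈ → earlier (par a a∈) λ { refl → w∉j a∈ }

      other : ∀ {j} → Ready (suc (toℕ w)) j → j ≢ w
      other (_ , w<j , _) refl = <-irrefl refl w<j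

      supply′ : ∀ j → Ready (suc (toℕ w)) j → HasPair fam′ host′ j ⊎ HasToken fam′ host′ own′ j
      supply′ j r with w ∈? P j
      ... | yes w∈ with supply-new (proj₁ (proj₂ r)) (new r w∈)
      ...   | inj₁ pair = inj₁ pair
      ...   | inj₂ tok  = inj₂ record
        { key = key ; side = side ; vertex = vertex ; point = point ; parent = parent
        ; owned = inj₁ (w∈ , owned) ; tip = tip ; apart = apart }
        where open HasToken tok
      supply′ j r | no w∉j with supply j (ready r w∉j)
      ... | inj₁ (a , b , a∈ , b∈ , a≢b , p , bg) = inj₁ (a , b , a∈ , b∈ , a≢b ,
        subst (λ κ → ∃ λ q → Bag₂ (fam′ κ) q a b) (sym (update-old λ { refl → w∉j a∈ }))
          (step-bag₂ entries (host a) bg))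
      ... | inj₂ tok = inj₂ record
        { key = key ; side = side ; vertex = vertex ; point = proj₁ moved ; parent = parent
        ; owned = inj₂ (w∉j , owned) ; tip = proj₂ moved
        ; apart = λ d d∈ eq → apart d d∈ (trans (sym (update-old λ { refl → w∉j d∈ })) eq) }
        where
        open HasToken tok
        moved : ∃ λ q → End side (fam′ key) q vertex
        moved = step-end entries key (λ a∈ → harmless a∈ (ready r w∉j) (other r) owned tip) tip

      exclusive′ : ∀ {j j′ κ s} → Ready (suc (toℕ w)) j → Ready (suc (toℕ w)) j′ →
                   own′ j κ s → own′ j′ κ s → j ≡ j′
      exclusive′ r r′ (inj₁ (w∈ , l)) (inj₁ (w∈′ , l′)) =
        label-inj (proj₁ (proj₂ r)) (proj₁ (proj₂ r′)) (new r w∈) (new r′ w∈′) l l′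
      exclusive′ r r′ (inj₁ (_ , l)) (inj₂ (w∉′ , o)) =
        contradiction o (label-new (ready r′ w∉′) (other r′) l)
      exclusive′ r r′ (inj₂ (w∉j , o)) (inj₁ (_ , l)) =
        contradiction o (label-new (ready r w∉j) (other r) l)
      exclusive′ r r′ (inj₂ (w∉j , o)) (inj₂ (w∉′ , o′)) =
        exclusive (ready r w∉j) (ready r′ w∉′) o o′

    -- Assembling a plan from entries at hosts and new graphs

    host-old : ∀ {c} → c ∈ P w → toℕ (proj₁ (host c)) < toℕ w
    host-old {c} c∈ with toℕ (proj₁ (host c)) <? toℕ w
    ... | yes h<w = h<w
    -- The graph of an unprocessed key is empty, whereas `c` is alone somewhere in its host.
    ... | no  h≮w = contradiction (proj₁ (proj₁ (proj₂ (bag c (below c∈))))) (fresh (≮⇒≥ h≮w))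

    old≢own : ∀ {y : Fin m} {κ : Key} → toℕ (proj₁ κ) < toℕ w → κ ≢ (w , y)
    old≢own κ<w refl = <-irrefl refl κ<w

    Neighbour : Fin m → Set
    Neighbour c = c ∈ P w × adj G w c ≡ true

    -- The short interval sits where `c` is alone, so `w c` is the only edge that arises.
    hostEntry : ∃ Neighbour → Entry
    hostEntry (c , c∈ , e) = host c , at (proj₁ (bag c (below c∈)))
      (λ u o → subst (λ v → adj G w v ≡ true) (sym (proj₂ (proj₂ (bag c (below c∈))) u o)) e)

    empty : ∀ {y p} → Empty (fam (w , y)) p
    empty v (v∈ , _) = fresh ≤-refl v∈

    -- The graph is still empty, so the point 0 is as good as any other.
    ownEntry : Fin m → Entry
    ownEntry y = (w , y) , at 0 (λ u o → contradiction o (empty u))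

    toList⁺ : ∀ {cs c} (nb : All Neighbour cs) → c L.∈ cs → ∃ λ pf → (c , pf) L.∈ All.toList nb
    toList⁺ (n ∷ nb) (here refl) = n , here refl
    toList⁺ (n ∷ nb) (there c∈)  with pf , ∈l ← toList⁺ nb c∈ = pf , there ∈l

    toList⁻ : ∀ {cs c pf} (nb : All Neighbour cs) → (c , pf) L.∈ All.toList nb → c L.∈ cs
    toList⁻ (n ∷ nb) (here refl) = here refl
    toList⁻ (n ∷ nb) (there ∈l)  = there (toList⁻ nb ∈l)

    length-toList : ∀ {cs} (nb : All Neighbour cs) → length (All.toList nb) ≡ length cs
    length-toList []       = refl
    length-toList (n ∷ nb) = cong suc (length-toList nb)

    module Layout
      (special        : List Entry)
      (special-unique : ∀ {e e′} → e L.∈ special → e′ L.∈ special → e ≡ e′)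
      (special-old    : ∀ {e} → e L.∈ special → toℕ (proj₁ (proj₁ e)) < toℕ w)
      (cs             : List (Fin m))
      (neighbours     : All Neighbour cs)
      (special-apart  : ∀ {e c} → e L.∈ special → c L.∈ cs → host c ≢ proj₁ e)
      (hosts-differ   : ∀ {c c′} → c L.∈ cs → c′ L.∈ cs → host c ≡ host c′ → c ≡ c′)
      (ys             : List (Fin m))
      where

      hosts owns entries : List Entry
      hosts   = map hostEntry (All.toList neighbours)
      owns    = map ownEntry ys
      entries = special ++ hosts ++ owns

      length-entries : length entries ≡ length special + (length cs + length ys)
      length-entries = trans (length-++ special) (cong (length special +_)
        (trans (length-++ hosts) (cong₂ _+_
          (trans (length-map hostEntry (All.toList neighbours)) (length-toList neighbours))
          (length-map ownEntry ys))))

      data Source : Entry → Set where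
        isSpecial : ∀ {e} → e L.∈ special → Source e
        isHost    : ∀ {c} pf → c L.∈ cs → Source (hostEntry (c , pf))
        isOwn     : ∀ {y} → y L.∈ ys → Source (ownEntry y)

      source : ∀ {e} → e L.∈ entries → Source e
      source e∈ with L.∈-++⁻ special e∈
      ... | inj₁ e∈s = isSpecial e∈s
      ... | inj₂ e∈r with L.∈-++⁻ hosts e∈r
      ...   | inj₁ e∈h with (c , pf) , ∈l , refl ← L.∈-map⁻ hostEntry e∈h =
        isHost pf (toList⁻ neighbours ∈l)
      ...   | inj₂ e∈o with y , y∈ , refl ← L.∈-map⁻ ownEntry e∈o = isOwn y∈

      keys : ∀ {x y a} → ((x , y) , a) L.∈ entries → toℕ x ≤ toℕ w
      keys e∈ = go (source e∈)
        where
        go : ∀ {e} → Source e → toℕ (proj₁ (proj₁ e)) ≤ toℕ w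
        go (isSpecial e∈s)    = <⇒≤ (special-old e∈s)
        go (isHost (c∈ , _) _) = <⇒≤ (host-old c∈)
        go (isOwn _)          = ≤-refl

      between-special : ∀ {κ p A B} → (κ , between p A B) L.∈ entries → (κ , between p A B) L.∈ special
      between-special e∈ = go (source e∈) refl
        where
        go : ∀ {e κ p A B} → Source e → e ≡ (κ , between p A B) → (κ , between p A B) L.∈ special
        go (isSpecial e∈s) refl = e∈s
        go (isHost _ _)    ()
        go (isOwn _)       ()

      step-special : ∀ (Q : IntervalSubgraph G → Set) {κ a} → (κ , a) L.∈ special →
                     Q (insert (fam κ) a) → Q (step entries κ)
      step-special Q {κ} {a} e∈ q = step-elim Q entries (L.∈-++⁺ˡ e∈) λ e′ e′∈ eq → go (source e′∈) eq
        where
        go : ∀ {e′} → Source e′ → proj₁ e′ ≡ κ → Q (insert (fam (proj₁ e′)) (proj₂ e′))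
        go (isSpecial e∈′) _ with refl ← special-unique e∈ e∈′ = q
        go (isHost _ c∈)  eq = contradiction eq (special-apart e∈ c∈)
        go (isOwn _)      eq = contradiction (sym eq) (old≢own (special-old e∈))

      -- The three groups of entries have disjoint keys and the hosts of `cs` differ, so the entry
      -- for `c` does take effect, and meeting `c` alone creates a pair.
      step-host : ∀ {c} → c L.∈ cs → ∃ λ q → Bag₂ (step entries (host c)) q c w
      step-host {c} c∈ with pf , ∈l ← toList⁺ neighbours c∈ =
        step-elim (λ I → ∃ λ q → Bag₂ I q c w) entries
          (L.∈-++⁺ʳ special (L.∈-++⁺ˡ (L.∈-map⁺ hostEntry ∈l))) λ e′ e′∈ eq → go (source e′∈) eq
        where
        go : ∀ {e′} → Source e′ → proj₁ e′ ≡ host c →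
             ∃ λ q → Bag₂ (insert (fam (proj₁ e′)) (proj₂ e′)) q c w
        go (isSpecial e∈) eq = contradiction (sym eq) (special-apart e∈ c∈)
        go (isHost {c′} pf@(c′∈w , _) c∈′) eq with refl ← hosts-differ c∈′ c∈ eq = _ ,
          insert-bag₂ (proj₂ (hostEntry (c′ , pf))) {1} (s≤s z≤n) ≤-refl ≤-refl
            (<⇒≢w (below c′∈w)) (proj₂ (bag c′ (below c′∈w)))
        go (isOwn _) eq = contradiction (sym eq)
          (old≢own (host-old (proj₁ (All.lookup neighbours c∈))))

      step-own : ∀ s {y} → y L.∈ ys → ∃ λ q → End s (step entries (w , y)) q w
      step-own s {y} y∈ = step-elim (λ I → ∃ λ q → End s I q w) entries
        (L.∈-++⁺ʳ special (L.∈-++⁺ʳ hosts (L.∈-map⁺ ownEntry y∈))) λ e′ e′∈ eq → go (source e′∈) eq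
        where
        go : ∀ {e′} → Source e′ → proj₁ e′ ≡ (w , y) →
             ∃ λ q → End s (insert (fam (proj₁ e′)) (proj₂ e′)) q w
        go (isSpecial e∈)      eq = contradiction eq (old≢own (special-old e∈))
        go (isHost (c∈ , _) _) eq = contradiction eq (old≢own (host-old c∈))
        go (isOwn {y′} _)      eq = insert-ends {fam (w , y′)} s empty

      host-pair : ∀ {h j c} → New w j → c L.∈ cs → c ∈ P j → HasPair (step entries) (update h) j
      host-pair {h} {c = c} new c∈ c∈j = c , w , c∈j , contains new , c≢w ,
        subst (λ κ → ∃ λ q → Bag₂ (step entries κ) q c w) (sym (update-old c≢w)) (step-host c∈)
        where c≢w = <⇒≢w (below (proj₁ (All.lookup neighbours c∈)))

      -- Earlier vertices have older hosts, so among the parents of `j` only `w` can be hosted at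
      -- `(w , y)`, and only for `y ≡ w`; this is why `k ≤ 2` is asked in that case.
      own-token : ∀ {label j y} s → New w j → y L.∈ ys → (y ≡ w → k ≤ 2) → label j (w , y) s →
                  HasToken (step entries) (update (w , w)) label j
      own-token {j = j} {y} s new y∈ small l with q , e ← step-own s y∈ = record
        { key = w , y ; side = s ; vertex = w ; point = q ; parent = contains new
        ; owned = l ; tip = e ; apart = apart }
        where
        apart : ∀ d → d ∈ P j → update (w , w) d ≡ (w , y) → d ≡ w × k ≤ 2
        apart d d∈ eq with d ≟ w
        ... | yes refl = refl , small (sym (cong proj₂ eq))
        ... | no  d≢w  = contradiction eq (old≢own (host-old (parent-split new d∈ d≢w)))

    -- Parents of `w` are adjacent in the tree, so `separate` applies to them.
    same-host : ∀ {c c′} → c ∈ P w → c′ ∈ P w → c ≢ c′ → host c ≡ host c′ → k ≤ 2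
    same-host c∈ c′∈ c≢c′ eq with comparable c∈ c′∈ c≢c′
    ... | inj₁ c∈c′ = separate c∈c′ (below c′∈) eq
    ... | inj₂ c′∈c = separate c′∈c (below c∈) (sym eq)

    two-parents : ∀ {a b} → a ∈ P w → b ∈ P w → a ≢ b → 2 ≤ ∣ P w ∣
    two-parents a∈ b∈ a≢b = length≤∣ P w ∣ ((a≢b ∷ []) ∷ [] ∷ [])
      λ { (here refl) → a∈ ; (there (here refl)) → b∈ }

    three-parents : ∀ {a b c} → a ∈ P w → b ∈ P w → c ∈ P w → a ≢ b → a ≢ c → b ≢ c → 3 ≤ ∣ P w ∣
    three-parents a∈ b∈ c∈ a≢b a≢c b≢c = length≤∣ P w ∣
      ((a≢b ∷ a≢c ∷ []) ∷ (b≢c ∷ []) ∷ [] ∷ [])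
      λ { (here refl) → a∈ ; (there (here refl)) → b∈ ; (there (there (here refl))) → c∈ }

    distinct-hosts : ∀ {c c′} → c ∈ P w → c′ ∈ P w → (c ≢ c′ → 3 ≤ k) → host c ≡ host c′ → c ≡ c′
    distinct-hosts {c} {c′} c∈ c′∈ large eq with c ≟ c′
    ... | yes c≡c′ = c≡c′
    ... | no  c≢c′ = contradiction (large c≢c′) (≤⇒≯ (same-host c∈ c′∈ c≢c′ eq))

    -- Plans that cover the edges to the parents one by one

    nbrs : List (Fin m)
    nbrs = filter (λ c → adj G w c Bool.≟ true) (elems (P w))

    ∈-nbrs⁺ : ∀ {c} → c ∈ P w → adj G w c ≡ true → c L.∈ nbrs
    ∈-nbrs⁺ c∈ e = L.∈-filter⁺ (λ c → adj G w c Bool.≟ true) (∈-elems⁺ c∈) e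

    ∈-nbrs⁻ : ∀ {c} → c L.∈ nbrs → Neighbour c
    ∈-nbrs⁻ c∈ with c∈′ , e ← L.∈-filter⁻ (λ c → adj G w c Bool.≟ true) c∈ = ∈-elems⁻ (P w) c∈′ , e

    nbrs-unique : Unique nbrs
    nbrs-unique = Unique.filter⁺ (λ c → adj G w c Bool.≟ true) (elems-unique (P w))

    -- The first alternative leads to the pair of `c` and `w`, the second to a free end of `w` in
    -- its graph `(w , y)`.
    Supplied : List (Fin m) → (Fin m → Fin m → Side → Set) → Fin m → Set
    Supplied ys label j = (∃ λ c → c L.∈ nbrs × c ∈ P j) ⊎
      (∃₂ λ y s → y L.∈ w ∷ ys × (y ≡ w → k ≤ 2) × label j y s)

    -- The edges to the parents are covered one by one; this leaves room for the
    -- further graphs (w , y) only if w misses some parents.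
    one-by-one : (ys : List (Fin m)) → length nbrs + suc (length ys) ≤ k →
      (∀ {c c′} → c ∈ P w → c′ ∈ P w → adj G w c ≡ true → adj G w c′ ≡ true → c ≢ c′ → k ≤ 2 → ⊥) →
      (label : Fin m → Fin m → Side → Set) →
      (∀ {j j′ y s} → toℕ w < toℕ j → toℕ w < toℕ j′ → New w j → New w j′ →
        label j y s → label j′ y s → j ≡ j′) →
      (∀ {j} → toℕ w < toℕ j → New w j → Supplied ys label j) →
      Plan
    one-by-one ys short large label label-inj supply-new = record
      { entries    = entries
      ; host-w     = w , w
      ; label      = λ j (x , y) s → x ≡ w × label j y s
      ; keys       = keys
      ; short      = subst (_≤ k) (sym length-entries) short
      ; bag-w      = end-tip {I = step entries (w , w)} before (proj₂ (step-own before (here refl)))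
      ; cover-w    = λ c∈ e → let q , oc , ow , _ = step-host (∈-nbrs⁺ c∈ e) in _ , q , ow , oc
      ; separate-w = λ a∈ eq → contradiction eq (old≢own (host-old a∈))
      ; harmless   = λ e∈ → case between-special e∈ of λ ()
      ; label-old  = λ { (refl , _) → ≤-refl }
      ; label-inj  = λ { w<j w<j′ n n′ (_ , l) (_ , l′) → label-inj w<j w<j′ n n′ l l′ }
      ; label-new  = λ { _ _ (refl , _) o → <-irrefl refl (own-old o) }
      ; supply-new = λ w<j new → case supply-new w<j new of λ where
          (inj₁ (c , c∈ , c∈j))          → inj₁ (host-pair new c∈ c∈j)
          (inj₂ (y , s , y∈ , small , l)) → inj₂ (own-token s new y∈ small (refl , l))
      }
      where
      unique : ∀ {e e′ : Entry} → e L.∈ [] → e′ L.∈ [] → e ≡ e′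
      unique ()
      older : ∀ {e : Entry} → e L.∈ [] → toℕ (proj₁ (proj₁ e)) < toℕ w
      older ()
      apart : ∀ {e : Entry} {c} → e L.∈ [] → c L.∈ nbrs → host c ≢ proj₁ e
      apart ()
      differ : ∀ {c c′} → c L.∈ nbrs → c′ L.∈ nbrs → host c ≡ host c′ → c ≡ c′
      differ c∈ c′∈ with c∈w , wc ← ∈-nbrs⁻ c∈ | c′∈w , wc′ ← ∈-nbrs⁻ c′∈ =
        distinct-hosts c∈w c′∈w λ c≢c′ → ≰⇒> (large c∈w c′∈w wc wc′ c≢c′)
      open Layout [] unique older nbrs (All.tabulate ∈-nbrs⁻) apart differ (w ∷ ys)

    -- With fewer than `k` parents there is room for the own graph. A new clique contains all
    -- parents of `w`, so any neighbour gives a pair; ends are needed only if there is no neighbour.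
    initial-plan : toℕ w < k → Plan
    initial-plan w<k = one-by-one ys (short nbrs refl) large label label-inj supply-new
      where
      vₖ : Fin m
      vₖ = fromℕ< (enough T)
      vₖ≢w : vₖ ≢ w
      vₖ≢w refl = <-irrefl (toℕ-fromℕ< (enough T)) w<k
      -- For `k ≥ 3` a token must avoid the host `(w , w)`, so one more graph is opened; `vₖ` is
      -- just a name different from `w`.
      spares : List (Fin m) → List (Fin m)
      spares (_ ∷ _) = []
      spares []      with k ≤? 2
      ... | yes _ = []
      ... | no  _ = vₖ ∷ []
      ys : List (Fin m)
      ys = spares nbrs
      few-nbrs : length nbrs ≤ toℕ w
      few-nbrs = subst (length nbrs ≤_) (size-initial (<⇒≤ w<k))
        (length≤∣ P w ∣ nbrs-unique (proj₁ ∘ ∈-nbrs⁻))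
      short : ∀ ns → nbrs ≡ ns → length ns + suc (length (spares ns)) ≤ k
      short (n ∷ ns) eq = subst (_≤ k) (+-comm 1 (suc (length ns)))
        (≤-<-trans (subst (λ l → length l ≤ toℕ w) eq few-nbrs) w<k)
      short [] _ with k ≤? 2
      ... | yes _   = ≤-<-trans z≤n w<k
      ... | no  k≰2 = <⇒≤ (≰⇒> k≰2)
      large : ∀ {c c′} → c ∈ P w → c′ ∈ P w → adj G w c ≡ true → adj G w c′ ≡ true → c ≢ c′ → k ≤ 2 → ⊥
      large c∈ c′∈ _ _ c≢c′ k≤2 =
        <⇒≱ w<k (≤-trans k≤2 (subst (2 ≤_) (size-initial (<⇒≤ w<k)) (two-parents c∈ c′∈ c≢c′)))
      -- Two vertices may be attached to the initial k-clique: vertex k and a later one.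
      label : Fin m → Fin m → Side → Set
      label j _ before = toℕ j ≡ k
      label j _ after  = k < toℕ j
      label-inj : ∀ {j j′ y s} → toℕ w < toℕ j → toℕ w < toℕ j′ → New w j → New w j′ →
                  label j y s → label j′ y s → j ≡ j′
      label-inj {s = before} _ _ _ _ l l′  = toℕ-injective (trans l (sym l′))
      label-inj {s = after}  _ _ n n′ l l′ = later-simple T _ _ l l′ (initial-same w<k n n′)
      spare : ∀ ns → ∃ λ y → ns ≡ [] → y L.∈ w ∷ spares ns × (y ≡ w → k ≤ 2)
      spare (_ ∷ _) = w , λ ()
      spare [] with k ≤? 2
      ... | yes k≤2 = w , λ _ → here refl , λ _ → k≤2
      ... | no  _   = vₖ , λ _ → there (here refl) , λ eq → contradiction eq vₖ≢w
      side-of : ∀ {j} → New w j → ∃ λ s → ∀ y → label j y s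
      side-of {j} new with m≤n⇒m<n∨m≡n (late new)
      ... | inj₁ k<j = after , λ _ → k<j
      ... | inj₂ k≡j = before , λ _ → sym k≡j
      supply-new : ∀ {j} → toℕ w < toℕ j → New w j →
                   Supplied ys label j
      supply-new {j} _ new = go nbrs refl
        where
        go : ∀ ns → nbrs ≡ ns → Supplied ys label j
        go (c ∷ _) eq = inj₁ (c , c∈ , initial-parents w<k new (proj₁ (∈-nbrs⁻ c∈)))
          where
          c∈ : c L.∈ nbrs
          c∈ = subst (c L.∈_) (sym eq) (here refl)
        go [] eq with y , y-ok ← spare nbrs with s , l ← side-of new =
          inj₂ (y , s , proj₁ (y-ok eq) , proj₂ (y-ok eq) , l y)

    module Late (k≤w : k ≤ toℕ w) where

      size-w : ∣ P w ∣ ≡ k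
      size-w = size k≤w

      length-elems-w : length (elems (P w)) ≡ k
      length-elems-w = trans (length-elems (P w)) size-w

      -- The tokens at w for a new vertex whose clique misses the parent d of w.
      code : (e y₀ d : Fin m) → Fin m × Side
      code e y₀ d with k ≤? 2 | d ≟ e
      ... | yes _ | yes _ = w , before
      ... | yes _ | no  _ = w , after
      ... | no  _ | yes _ = y₀ , before
      ... | no  _ | no  _ = d , after

      -- For `k ≤ 2` there is at most one parent besides `e`. For `k ≥ 3` such parents are told
      -- apart by their graphs, and `e` from them by its side.
      code-inj : ∀ {e y₀ d d′} → e ∈ P w → d ∈ P w → d′ ∈ P w → code e y₀ d ≡ code e y₀ d′ → d ≡ d′
      code-inj {e} {y₀} {d} {d′} e∈ d∈ d′∈ eq with k ≤? 2 | d ≟ e | d′ ≟ e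
      code-inj e∈ d∈ d′∈ ()   | yes _ | yes _ | no _
      code-inj e∈ d∈ d′∈ ()   | yes _ | no _  | yes _
      code-inj e∈ d∈ d′∈ ()   | no _  | yes _ | no _
      code-inj e∈ d∈ d′∈ ()   | no _  | no _  | yes _
      code-inj e∈ d∈ d′∈ _    | _     | yes refl | yes refl = refl
      code-inj e∈ d∈ d′∈ refl | no _  | no _ | no _ = refl
      code-inj {d = d} {d′} e∈ d∈ d′∈ _ | yes k≤2 | no d≢e | no d′≢e with d ≟ d′
      ... | yes d≡d′ = d≡d′
      ... | no  d≢d′ = contradiction (subst (3 ≤_) size-w (three-parents d∈ d′∈ e∈ d≢d′ d≢e d′≢e)) (≤⇒≯ k≤2)

      Label : (e y₀ : Fin m) → Fin m → Fin m → Side → Set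
      Label e y₀ j y s = ∃ λ d → d ∈ P w × d ∉ P j × code e y₀ d ≡ (y , s)

      -- The end reveals the missing parent, and the missing parent reveals the vertex.
      Label-inj : ∀ {e y₀} → e ∈ P w → ∀ {j j′ y s} → toℕ w < toℕ j → toℕ w < toℕ j′ →
                  New w j → New w j′ → Label e y₀ j y s → Label e y₀ j′ y s → j ≡ j′
      Label-inj e∈ w<j w<j′ n n′ (d , d∈ , d∉ , eq) (d′ , d′∈ , d′∉ , eq′)
        with refl ← code-inj e∈ d∈ d′∈ (trans eq (sym eq′)) =
        missing-determines k≤w w<j w<j′ n n′ d∈ d∉ d′∉

      code-small : ∀ {e y₀} d → k ≤ 2 → proj₁ (code e y₀ d) ≡ w
      code-small {e} d k≤2 with k ≤? 2 | d ≟ e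
      ... | yes _   | yes _ = refl
      ... | yes _   | no  _ = refl
      ... | no  k≰2 | _     = contradiction k≤2 k≰2

      code-large : ∀ {e y₀} d → ¬ k ≤ 2 →
                   (d ≡ e × proj₁ (code e y₀ d) ≡ y₀) ⊎ (d ≢ e × proj₁ (code e y₀ d) ≡ d)
      code-large {e} d k≰2 with k ≤? 2 | d ≟ e
      ... | no  _   | yes d≡e = inj₁ (d≡e , refl)
      ... | no  _   | no  d≢e = inj₂ (d≢e , refl)
      ... | yes k≤2 | _       = contradiction k≤2 k≰2

      -- The absent edge to `e` saves one graph, which becomes the own graph of `w`. A clique
      -- without neighbours of `w` misses only one parent, so ends are needed only if `w` has at
      -- most one neighbour.
      missed-plan : ∀ {e} → e ∈ P w → adj G w e ≢ true → Plan
      missed-plan {e} e∈ we∉G = one-by-one ys (short (k ≤? 2) nbrs refl) large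
        (Label e y₀) (Label-inj e∈) supply-new
        where
        spec : Dec (k ≤ 2) → ∃ λ y → y ∈ P w × (¬ k ≤ 2 → y ≢ e)
        spec (yes k≤2) = e , e∈ , λ k≰2 → contradiction k≤2 k≰2
        spec (no  k≰2) with y , y∈ , y∉ ← element-outside (P w) (e ∷ [])
                              (subst (1 <_) (sym size-w) (<⇒≤ (≰⇒> k≰2))) =
          y , y∈ , λ _ y≡e → y∉ (here y≡e)
        y₀-spec : ∃ λ y → y ∈ P w × (¬ k ≤ 2 → y ≢ e)
        y₀-spec = spec (k ≤? 2)
        y₀ : Fin m
        y₀ = proj₁ y₀-spec
        -- For `k ≥ 3` and no neighbour, each parent but `e` gets a graph, and the end for `e` is
        -- the other side of the graph of `y₀`. With one neighbour `d`, only the clique missing `d`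
        -- needs an end; with more, none does.
        spares : Dec (k ≤ 2) → List (Fin m) → List (Fin m)
        spares (yes _) _           = []
        spares (no  _) []          = remove e (elems (P w))
        spares (no  _) (d ∷ [])    = d ∷ []
        spares (no  _) (_ ∷ _ ∷ _) = []
        ys : List (Fin m)
        ys = spares (k ≤? 2) nbrs
        few-nbrs : length nbrs < k
        few-nbrs = subst (length nbrs <_) length-elems-w
          (filter-notAll (λ c → adj G w c Bool.≟ true) (elems (P w))
            (Any.map (λ { refl → we∉G }) (∈-elems⁺ e∈)))
        tight : ∀ ns → nbrs ≡ ns → length ns + 1 ≤ k
        tight ns eq = subst (_≤ k) (+-comm 1 (length ns)) (subst (λ l → length l < k) eq few-nbrs)
        short : ∀ dec ns → nbrs ≡ ns → length ns + suc (length (spares dec ns)) ≤ k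
        short (yes _)   ns          eq = tight ns eq
        short (no  _)   []          eq = subst (length (remove e (elems (P w))) <_) length-elems-w
                                           (length-remove (∈-elems⁺ e∈))
        -- Three graphs are used: the host of the neighbour, `(w , w)` and one spare.
        short (no  k≰2) (_ ∷ [])    eq = ≰⇒> k≰2
        short (no  _)   (c ∷ d ∷ r) eq = tight (c ∷ d ∷ r) eq
        large : ∀ {c c′} → c ∈ P w → c′ ∈ P w → adj G w c ≡ true → adj G w c′ ≡ true → c ≢ c′ → k ≤ 2 → ⊥
        large c∈ c′∈ wc wc′ c≢c′ = <⇒≱ (subst (3 ≤_) size-w
          (three-parents c∈ c′∈ e∈ c≢c′ (λ { refl → we∉G wc }) (λ { refl → we∉G wc′ })))
        supply-new : ∀ {j} → toℕ w < toℕ j → New w j → Supplied ys (Label e y₀) j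
        supply-new {j} _ new with Any.any? (_∈? P j) nbrs
        ... | yes some = inj₁ (Any.lookup some , L.∈-lookup (Any.index some) , Any.lookup-result some)
        ... | no  none with d , d∈ , d∉ ← missing k≤w new =
          inj₂ (proj₁ (code e y₀ d) , proj₂ (code e y₀ d) , listed , small , d , d∈ , d∉ , refl)
          where
          only-d : ∀ {c} → c L.∈ nbrs → c ≡ d
          only-d {c} c∈ with c ≟ d
          ... | yes c≡d = c≡d
          ... | no  c≢d = contradiction (L.lose c∈ (present k≤w new d∈ d∉ (proj₁ (∈-nbrs⁻ c∈)) c≢d)) none
          small : proj₁ (code e y₀ d) ≡ w → k ≤ 2
          small eq = decidable-stable (k ≤? 2) λ k≰2 → case code-large {e} {y₀} d k≰2 of λ where
            (inj₁ (_ , eq′)) → <⇒≢w (below (proj₁ (proj₂ y₀-spec))) (trans (sym eq′) eq)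
            (inj₂ (_ , eq′)) → <⇒≢w (below d∈) (trans (sym eq′) eq)
          listed : proj₁ (code e y₀ d) L.∈ w ∷ ys
          listed = go (k ≤? 2) nbrs refl
            where
            go : ∀ dec ns → nbrs ≡ ns → proj₁ (code e y₀ d) L.∈ w ∷ spares dec ns
            go (yes k≤2) ns eq = here (code-small {e} {y₀} d k≤2)
            go (no k≰2) [] eq with code-large {e} {y₀} d k≰2
            ... | inj₁ (_ , eq′)   = there (subst (L._∈ remove e (elems (P w))) (sym eq′)
              (∈-remove⁺ (∈-elems⁺ (proj₁ (proj₂ y₀-spec))) (proj₂ (proj₂ y₀-spec) k≰2)))
            ... | inj₂ (d≢e , eq′) = there (subst (L._∈ remove e (elems (P w))) (sym eq′)
              (∈-remove⁺ (∈-elems⁺ d∈) d≢e))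
            go (no k≰2) (c ∷ []) eq with c∈ ← subst (c L.∈_) (sym eq) (here refl)
                                    with code-large {e} {y₀} d k≰2
            ... | inj₁ (d≡e , _) = contradiction
              (subst (λ v → adj G w v ≡ true) (trans (only-d c∈) d≡e) (proj₂ (∈-nbrs⁻ c∈))) we∉G
            ... | inj₂ (_ , eq′) = there (here (trans eq′ (sym (only-d c∈))))
            go (no _) (c ∷ c′ ∷ r) eq with subst Unique eq nbrs-unique
            ... | (c≢c′ ∷ _) ∷ _ = contradiction
              (trans (only-d (subst (c L.∈_) (sym eq) (here refl)))
                (sym (only-d (subst (c′ L.∈_) (sym eq) (there (here refl)))))) c≢c′

      -- Plans for a vertex adjacent to all its parents

      module Full (full : ∀ {c} → c ∈ P w → adj G w c ≡ true) where

        parent : ∀ {c} → c L.∈ elems (P w) → c ∈ P w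
        parent = ∈-elems⁻ (P w)

        -- One interval covers the edges to both `a` and `b`, so the own graph is number `k`. For
        -- `k = 2` its two ends serve the at most two new cliques; for `k ≥ 3` every new clique
        -- contains a pair.
        pair-plan : HasPair fam host w → Plan
        pair-plan (a , b , a∈ , b∈ , a≢b , p , onₐ , on_b , only) = record
          { entries    = entries
          ; host-w     = w , w
          ; label      = label
          ; keys       = keys
          ; short      = subst (_≤ k) (sym length-entries) short
          ; bag-w      = end-tip {I = step entries (w , w)} before (proj₂ (step-own before (here refl)))
          ; cover-w    = λ {c} c∈ _ → cover-w c c∈
          ; separate-w = λ a∈ eq → contradiction eq (old≢own (host-old a∈))
          ; harmless   = λ e∈ → case between-special e∈ of λ { (here ()) ; (there ()) }
          ; label-old  = λ { (refl , _) → ≤-refl }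
          ; label-inj  = λ { w<j w<j′ n n′ (_ , _ , l) (_ , _ , l′) → Label-inj a∈ w<j w<j′ n n′ l l′ }
          ; label-new  = λ { _ _ (refl , _) o → <-irrefl refl (own-old o) }
          ; supply-new = supply-new
          }
          where
          label : Fin m → Key → Side → Set
          label j (x , y) s = x ≡ w × k ≤ 2 × Label a a j y s
          place : Place (fam (host a))
          place = at p λ u o → [ (λ { refl → full a∈ }) , (λ { refl → full b∈ }) ]′ (only u o)
          cs : List (Fin m)
          cs = remove b (remove a (elems (P w)))
          cs⁻ : ∀ {c} → c L.∈ cs → c ∈ P w × c ≢ a × c ≢ b
          cs⁻ c∈ with c∈′ , c≢b ← ∈-remove⁻ c∈ with c∈″ , c≢a ← ∈-remove⁻ {xs = elems (P w)} c∈′ =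
            parent c∈″ , c≢a , c≢b
          k≥3 : ∀ {c} → c L.∈ cs → 3 ≤ k
          k≥3 c∈ with c∈w , c≢a , c≢b ← cs⁻ c∈ =
            subst (3 ≤_) size-w (three-parents c∈w a∈ b∈ c≢a c≢b a≢b)
          special : List Entry
          special = (host a , place) ∷ []
          unique : ∀ {e e′} → e L.∈ special → e′ L.∈ special → e ≡ e′
          unique (here refl) (here refl) = refl
          older : ∀ {e} → e L.∈ special → toℕ (proj₁ (proj₁ e)) < toℕ w
          older (here refl) = host-old a∈
          neighbours : All Neighbour cs
          neighbours = All.tabulate λ c∈ → proj₁ (cs⁻ c∈) , full (proj₁ (cs⁻ c∈))
          apart : ∀ {e c} → e L.∈ special → c L.∈ cs → host c ≢ proj₁ e
          apart (here refl) c∈ eq with c∈w , c≢a , _ ← cs⁻ c∈ =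
            c≢a (distinct-hosts c∈w a∈ (λ _ → k≥3 c∈) eq)
          differ : ∀ {c c′} → c L.∈ cs → c′ L.∈ cs → host c ≡ host c′ → c ≡ c′
          differ c∈ c′∈ = distinct-hosts (proj₁ (cs⁻ c∈)) (proj₁ (cs⁻ c′∈)) λ _ → k≥3 c∈
          open Layout special unique older cs neighbours apart differ (w ∷ [])
          short : 1 + (length cs + 1) ≤ k
          short = begin
            1 + (length cs + 1)                   ≡⟨ cong suc (+-comm (length cs) 1) ⟩
            2 + length cs                         ≤⟨ s≤s (length-remove (∈-remove⁺ (∈-elems⁺ b∈) (a≢b ∘ sym))) ⟩
            1 + length (remove a (elems (P w)))   ≤⟨ length-remove (∈-elems⁺ a∈) ⟩
            length (elems (P w))                  ≡⟨ length-elems-w ⟩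
            k                                     ∎
            where open ≤-Reasoning
          both : ∀ c → On (fam (host a)) p c → c ≢ w →
                 ∃₂ λ κ q → On (step entries κ) q w × On (step entries κ) q c
          both c o c≢w = host a , step-special (λ I → ∃ λ q → On I q w × On I q c) (here refl)
            (_ , on-new place ≤-refl ≤-refl , on-old place {1} {p} (s≤s z≤n) c≢w o)
          cover-w : ∀ c → c ∈ P w → ∃₂ λ κ q → On (step entries κ) q w × On (step entries κ) q c
          cover-w c c∈ with c ≟ a | c ≟ b
          ... | yes refl | _        = both a onₐ (<⇒≢w (below a∈))
          ... | no  _    | yes refl = both b on_b (<⇒≢w (below b∈))
          ... | no  c≢a  | no  c≢b
            with q , oc , ow , _ ← step-host (∈-remove⁺ (∈-remove⁺ (∈-elems⁺ c∈) c≢a) c≢b) = _ , q , ow , oc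
          supply-new : ∀ {j} → toℕ w < toℕ j → New w j →
                       HasPair (step entries) (update (w , w)) j ⊎
                       HasToken (step entries) (update (w , w)) label j
          supply-new {j} _ new = go (a ∈? P j ×-dec b ∈? P j) (k ≤? 2)
            where
            go : Dec (a ∈ P j × b ∈ P j) → Dec (k ≤ 2) → HasPair (step entries) (update (w , w)) j ⊎
                 HasToken (step entries) (update (w , w)) label j
            -- The old pair is still there: `w` does not cover all copies of its point.
            go (yes (a∈j , b∈j)) _ = inj₁ (a , b , a∈j , b∈j , a≢b ,
              subst (λ κ → ∃ λ q → Bag₂ (step entries κ) q a b) (sym (update-old (<⇒≢w (below a∈))))
                (step-bag₂ entries (host a) (onₐ , on_b , only)))
            go (no _) (yes k≤2) with d , d∈ , d∉ ← missing k≤w new =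
              inj₂ (own-token (proj₂ (code a a d)) new (here (code-small {a} {a} d k≤2)) (λ _ → k≤2)
                (refl , k≤2 , d , d∈ , d∉ , refl))
            go (no ¬ab∈) (no k≰2) with d , d∈ , d∉ ← missing k≤w new
                with c , c∈ , c∉ ← element-outside (P w) (a ∷ b ∷ []) (subst (2 <_) (sym size-w) (≰⇒> k≰2)) =
              inj₁ (host-pair new
                (∈-remove⁺ (∈-remove⁺ (∈-elems⁺ c∈) (c∉ ∘ here)) (λ eq → c∉ (there (here eq))))
                -- If the third parent `c` were the missing one, `a` and `b` would both be present.
                (present k≤w new d∈ d∉ c∈ λ { refl → ¬ab∈
                  ( present k≤w new d∈ d∉ a∈ (c∉ ∘ here ∘ sym)
                  , present k≤w new d∈ d∉ b∈ (λ eq → c∉ (there (here (sym eq))))) }))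

        -- Laid across the reserved end, `w` meets `a` alone and also sticks out alone, so `key`
        -- doubles as its host. With the hosts of the other `k` minus 1 parents this makes `k`
        -- graphs.
        token-plan : HasToken fam host own w → Plan
        token-plan token = record
          { entries    = entries
          ; host-w     = key
          ; label      = label
          ; keys       = keys
          ; short      = subst (_≤ k) (sym length-entries) short
          ; bag-w      = end-tip {I = step entries key} side (proj₂ new-end)
          ; cover-w    = λ {c} c∈ _ → cover-w c c∈
          ; separate-w = λ {a} a∈ eq → proj₂ (apart a a∈ eq)
          ; harmless   = λ e∈ → harmless (between-special e∈)
          ; label-old  = λ { (refl , _) → <⇒≤ (own-old owned) }
          ; label-inj  = label-inj
          -- The end handed on replaces the one reserved for `w`, and nobody else held that.
          ; label-new  = λ { r j≢w (refl , refl , _) o → j≢w (exclusive r ready-w o owned) }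
          ; supply-new = supply-new
          }
          where
          open HasToken token renaming (vertex to a; parent to a∈; point to p)
          a≢w : a ≢ w
          a≢w = <⇒≢w (below a∈)
          ready-w : Ready (toℕ w) w
          ready-w = k≤w , ≤-refl , λ _ → below
          near : ∀ q → Bag₁ (fam key) q a → ∀ u → On (fam key) q u → adj G w u ≡ true
          near q (_ , only) u o = subst (λ v → adj G w v ≡ true) (sym (only u o)) (full a∈)
          far : ∀ q → Empty (fam key) q → ∀ u → On (fam key) q u → adj G w u ≡ true
          far q e u o = contradiction o (e u)
          joint : ∀ s → End s (fam key) p a → Place (fam key)
          joint before (e , b) = between p (far p e) (near (suc p) b)
          joint after  (b , e) = between p (near p b) (far (suc p) e)
          joint-end : ∀ s (e : End s (fam key) p a) → ∃ λ q → End s (insert (fam key) (joint s e)) q w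
          joint-end before (e , b) = extend-end {fam key} {p} {far p e} {near (suc p) b} before (e , b)
          joint-end after  (b , e) = extend-end {fam key} {p} {near p b} {far (suc p) e} after (b , e)
          joint-bag₂ : ∀ s (e : End s (fam key) p a) → ∃ λ q → Bag₂ (insert (fam key) (joint s e)) q a w
          joint-bag₂ before (e , b) = extend-bag₂ {fam key} {p} {far p e} {near (suc p) b} before a≢w (e , b)
          joint-bag₂ after  (b , e) = extend-bag₂ {fam key} {p} {near p b} {far (suc p) e} after a≢w (b , e)
          joint-point : ∀ s (e : End s (fam key) p a) {κ q A B} →
                        (κ , between q A B) ≡ (key , joint s e) → κ ≡ key × q ≡ p
          joint-point before e refl = refl , refl
          joint-point after  e refl = refl , refl
          cs : List (Fin m)
          cs = remove a (elems (P w))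
          cs⁻ : ∀ {c} → c L.∈ cs → c ∈ P w × c ≢ a
          cs⁻ c∈ with c∈′ , c≢a ← ∈-remove⁻ c∈ = parent c∈′ , c≢a
          special : List Entry
          special = (key , joint side tip) ∷ []
          unique : ∀ {e e′} → e L.∈ special → e′ L.∈ special → e ≡ e′
          unique (here refl) (here refl) = refl
          older : ∀ {e} → e L.∈ special → toℕ (proj₁ (proj₁ e)) < toℕ w
          older (here refl) = own-old owned
          neighbours : All Neighbour cs
          neighbours = All.tabulate λ c∈ → proj₁ (cs⁻ c∈) , full (proj₁ (cs⁻ c∈))
          off-key : ∀ {e c} → e L.∈ special → c L.∈ cs → host c ≢ proj₁ e
          off-key (here refl) c∈ eq with c∈w , c≢a ← cs⁻ c∈ = c≢a (proj₁ (apart _ c∈w eq))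
          differ : ∀ {c c′} → c L.∈ cs → c′ L.∈ cs → host c ≡ host c′ → c ≡ c′
          differ c∈ c′∈ with c∈w , c≢a ← cs⁻ c∈ | c′∈w , c′≢a ← cs⁻ c′∈ =
            distinct-hosts c∈w c′∈w λ c≢c′ →
              subst (3 ≤_) size-w (three-parents c∈w c′∈w a∈ c≢c′ c≢a c′≢a)
          open Layout special unique older cs neighbours off-key differ []
          new-end : ∃ λ q → End side (step entries key) q w
          new-end = step-special (λ I → ∃ λ q → End side I q w) (here refl) (joint-end side tip)
          new-bag₂ : ∃ λ q → Bag₂ (step entries key) q a w
          new-bag₂ = step-special (λ I → ∃ λ q → Bag₂ I q a w) (here refl) (joint-bag₂ side tip)
          short : 1 + (length cs + 0) ≤ k
          short = subst₂ _≤_ (cong suc (sym (+-identityʳ (length cs)))) length-elems-w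
            (length-remove (∈-elems⁺ a∈))
          cover-w : ∀ c → c ∈ P w → ∃₂ λ κ q → On (step entries κ) q w × On (step entries κ) q c
          cover-w c c∈ with c ≟ a
          ... | yes refl with q , oa , ow , _ ← new-bag₂ = key , q , ow , oa
          ... | no  c≢a  with q , oc , ow , _ ← step-host (∈-remove⁺ (∈-elems⁺ c∈) c≢a) = _ , q , ow , oc
          harmless : ∀ {κ q A B j s c r} → (κ , between q A B) L.∈ (key , joint side tip) ∷ [] →
                     Ready (toℕ w) j → j ≢ w → own j κ s → End s (fam κ) r c → q ≢ r
          -- A free end in the same gap is on the same side, so by exclusivity its owner is `w`.
          harmless (here eq) rj j≢w o e q≡r with refl , q≡p ← joint-point side tip eq
                                            with refl ← trans (sym q≡r) q≡p
                                            with refl ← ends-differ {I = fam key} e tip =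
            j≢w (exclusive rj ready-w o owned)
          label : Fin m → Key → Side → Set
          -- Handing on the end is needed only for `k = 1`. For larger `k`, a clique missing `a`
          -- contains another parent, which `w` met alone.
          label j κ s = κ ≡ key × s ≡ side × k ≤ 1
          label-inj : ∀ {j j′ κ s} → toℕ w < toℕ j → toℕ w < toℕ j′ → New w j → New w j′ →
                      label j κ s → label j′ κ s → j ≡ j′
          label-inj w<j w<j′ n n′ (_ , _ , k≤1) _
            with d , d∈ , d∉ ← missing k≤w n with d′ , d′∈ , d′∉ ← missing k≤w n′ with d ≟ d′
          ... | yes refl = missing-determines k≤w w<j w<j′ n n′ d∈ d∉ d′∉
          ... | no  d≢d′ = contradiction (subst (2 ≤_) size-w (two-parents d∈ d′∈ d≢d′)) (≤⇒≯ k≤1)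
          supply-new : ∀ {j} → toℕ w < toℕ j → New w j →
                       HasPair (step entries) (update key) j ⊎ HasToken (step entries) (update key) label j
          supply-new {j} _ new with a ∈? P j
          ... | yes a∈j = inj₁ (w , a , contains new , a∈j , a≢w ∘ sym ,
            subst (λ κ → ∃ λ q → Bag₂ (step entries κ) q w a) (sym update-new)
              (proj₁ new-bag₂ , bag₂-swap {I = step entries key} (proj₂ new-bag₂)))
          ... | no a∉j with k ≤? 1
          ...   | yes k≤1 = inj₂ record
            { key = key ; side = side ; vertex = w ; point = proj₁ new-end ; parent = contains new
            ; owned = refl , refl , k≤1 ; tip = proj₂ new-end ; apart = apart′ }
            where
            apart′ : ∀ d → d ∈ P j → update key d ≡ key → d ≡ w × k ≤ 2
            apart′ d d∈ eq with d ≟ w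
            ... | yes d≡w = d≡w , ≤-trans k≤1 (s≤s z≤n)
            ... | no  d≢w with refl , _ ← apart d (parent-split new d∈ d≢w) eq = contradiction d∈ a∉j
          ...   | no  k≰1 with c , c∈ , c∉ ← element-outside (P w) (a ∷ []) (subst (1 <_) (sym size-w) (≰⇒> k≰1)) =
            inj₁ (host-pair new (∈-remove⁺ (∈-elems⁺ c∈) (c∉ ∘ here))
              (present k≤w new a∈ a∉j c∈ (c∉ ∘ here)))

    -- Choice of the plan, the whole run and the final count

    plan : Plan
    plan with toℕ w <? k
    ... | yes w<k = initial-plan w<k
    ... | no  w≮k with all? (λ c → adj G w c Bool.≟ true) (elems (P w))
    ...   | no ¬full with c , c∈ , wc∉G ← L.find (All.¬All⇒Any¬ (λ c → adj G w c Bool.≟ true) _ ¬full) =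
      Late.missed-plan (≮⇒≥ w≮k) (∈-elems⁻ (P w) c∈) wc∉G
    ...   | yes full with supply w (≮⇒≥ w≮k , ≤-refl , λ _ → below)
    ...     | inj₁ pair  = Late.Full.pair-plan (≮⇒≥ w≮k) (All.lookup full ∘ ∈-elems⁺) pair
    ...     | inj₂ token = Late.Full.token-plan (≮⇒≥ w≮k) (All.lookup full ∘ ∈-elems⁺) token

  start : 1 ≤ k → State 0
  start 1≤k = record
    { fam       = λ _ → nothing-yet
    ; host      = λ v → v , v
    ; own       = λ _ _ _ → ⊥
    ; fresh     = λ _ ()
    ; old       = λ ()
    ; cover     = λ _ ()
    ; bag       = λ _ ()
    ; separate  = λ _ ()
    ; few       = λ _ ()
    -- Nothing is ready at the start: there are `k ≥ 1` parents, and none is processed.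
    ; supply    = λ j (k≤j , _ , none) →
        case element-outside (P j) [] (subst (0 <_) (sym (size k≤j)) 1≤k) of λ where
          (a , a∈ , _) → case none a a∈ of λ ()
    ; own-old   = λ ()
    ; exclusive = λ _ _ ()
    }
    where
    nothing-yet : IntervalSubgraph G
    nothing-yet = record
      { inV = λ _ → false ; left = λ _ → 0 ; right = λ _ → 0 ; nonempty = λ _ → z≤n
      ; sub = λ _ _ _ () }

  process : 1 ≤ k → ∀ t → t ≤ m → State t
  process 1≤k zero    _   = start 1≤k
  process 1≤k (suc t) t<m = subst (State ∘ suc) (toℕ-fromℕ< t<m) (Step.advance w S (Step.plan w S))
    where
    w : Fin m
    w = fromℕ< t<m
    S : State (toℕ w)
    S = subst State (sym (toℕ-fromℕ< t<m)) (process 1≤k t (<⇒≤ t<m))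

  allKeys : List Key
  allKeys = cartesianProduct (allFin m) (allFin m)

  countContaining≡length : ∀ (fam : Family) v κs →
    countContaining v (map fam κs) ≡ length (filter (λ κ → inV (fam κ) v Bool.≟ true) κs)
  countContaining≡length fam v []       = refl
  countContaining≡length fam v (κ ∷ κs) with inV (fam κ) v
  ... | true  = cong suc (countContaining≡length fam v κs)
  ... | false = countContaining≡length fam v κs

  on⇒edge : ∀ {I : IntervalSubgraph G} {p u v} → On I p u → On I p v → EdgeOf I u v
  on⇒edge (u∈ , lu , ru) (v∈ , lv , rv) = u∈ , v∈ , ≤-trans lu rv , ≤-trans lv ru

  localTrack : 1 ≤ k → LocalTrackAtMost G k
  localTrack 1≤k = map fam allKeys , covered , counted
    where
    open State (process 1≤k m ≤-refl)
    listed : ∀ {Q : IntervalSubgraph G → Set} κ → Q (fam κ) → Any Q (map fam allKeys)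
    listed κ q = Any.map⁺ (L.lose (L.∈-cartesianProduct⁺ (L.∈-allFin (proj₁ κ)) (L.∈-allFin (proj₂ κ))) q)
    covered : ∀ u v → adj G u v ≡ true → Any (λ I → EdgeOf I u v) (map fam allKeys)
    covered u v e with tree u v e
    ... | inj₁ (_ , u∈) with κ , p , ov , ou ← cover u∈ (toℕ<n v) (trans (Graph.sym G v u) e) =
      listed κ (on⇒edge {fam κ} {p} ou ov)
    ... | inj₂ (_ , v∈) with κ , p , ou , ov ← cover v∈ (toℕ<n u) e = listed κ (on⇒edge {fam κ} {p} ou ov)
    counted : ∀ v → countContaining v (map fam allKeys) ≤ k
    -- The graphs containing `v` have distinct keys, all of which occur in `κs`.
    counted v with κs , κs≤k , mem ← few v (toℕ<n v) =
      subst (_≤ k) (sym (countContaining≡length fam v allKeys))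
        (≤-trans (pigeonhole _≟K_
          (Unique.filter⁺ (λ κ → inV (fam κ) v Bool.≟ true)
            (Unique.cartesianProduct⁺ (Unique.allFin⁺ m) (Unique.allFin⁺ m)))
          (λ {κ} κ∈ → mem κ (proj₂ (L.∈-filter⁻ (λ κ → inV (fam κ) v Bool.≟ true) {xs = allKeys} κ∈))))
          κs≤k)

-- Reduction to spanning subgraphs of the tree

module _ {n m} (G : Graph n) (f : Fin n → Fin m) (f-inj : Injective _≡_ _≡_ f) where

  private
    arc? : ∀ a b → Dec (∃₂ λ u v → f u ≡ a × f v ≡ b × adj G u v ≡ true)
    arc? a b = any? λ u → any? λ v → f u ≟ a ×-dec f v ≟ b ×-dec adj G u v Bool.≟ true

    does-true : ∀ {A : Set} (a? : Dec A) → does a? ≡ true → A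
    does-true (yes a) _ = a

    flip-arc : ∀ {a b} → ∃₂ (λ u v → f u ≡ a × f v ≡ b × adj G u v ≡ true) →
               ∃₂ (λ u v → f u ≡ b × f v ≡ a × adj G u v ≡ true)
    flip-arc (u , v , p , q , e) = v , u , q , p , trans (Graph.sym G v u) e

  -- `G` drawn on the vertices of the tree; vertices outside the range of `f` become isolated.
  image : Graph m
  image = record
    { adj    = λ a b → does (arc? a b)
    ; sym    = λ a b → does-⇔ (mk⇔ flip-arc flip-arc) (arc? a b) (arc? b a)
    ; irrefl = λ a → dec-false (arc? a a) λ (u , v , p , q , e) →
        case trans (sym (Graph.irrefl G u)) (subst (λ x → adj G u x ≡ true) (f-inj (trans q (sym p))) e)
          of λ ()
    }

  image-adj⁺ : ∀ {u v} → adj G u v ≡ true → adj image (f u) (f v) ≡ true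
  image-adj⁺ {u} {v} e = dec-true (arc? (f u) (f v)) (u , v , refl , refl , e)

  image-adj⁻ : ∀ a b → adj image a b ≡ true → ∃₂ λ u v → f u ≡ a × f v ≡ b × adj G u v ≡ true
  image-adj⁻ a b = does-true (arc? a b)

  pullback : IntervalSubgraph image → IntervalSubgraph G
  pullback I = record
    { inV      = inV I ∘ f
    ; left     = left I ∘ f
    ; right    = right I ∘ f
    ; nonempty = nonempty I ∘ f
    ; sub      = λ u v u≢v u∈ v∈ l r →
        case image-adj⁻ (f u) (f v) (sub I (f u) (f v) (u≢v ∘ f-inj) u∈ v∈ l r) of λ where
          (_ , _ , p , q , e) → subst₂ (λ x y → adj G x y ≡ true) (f-inj p) (f-inj q) e
    }

  count-pullback : ∀ v Is → countContaining v (map pullback Is) ≡ countContaining (f v) Is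
  count-pullback v []       = refl
  count-pullback v (I ∷ Is) with inV I (f v)
  ... | true  = cong suc (count-pullback v Is)
  ... | false = count-pullback v Is

  pullback-localTrack : ∀ {k} → LocalTrackAtMost image k → LocalTrackAtMost G k
  pullback-localTrack {k} (Is , covered , counted) = map pullback Is ,
    (λ u v e → Any.map⁺ (covered (f u) (f v) (image-adj⁺ e))) ,
    (λ v → subst (_≤ k) (sym (count-pullback v Is)) (counted (f v)))

-- The construction needs `1 ≤ k`, so `k = 0` is settled separately: all parent sets have size 0.
0-tree-edgeless : ∀ {m} (T : SimpleKTree 0 m) a b → ¬ TreeAdj T a b
0-tree-edgeless T a b = [ no-parent , no-parent ]′
  where
  open Tree T
  no-parent : ∀ {a b} → ¬ (toℕ a < toℕ b × a ∈ P b)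
  no-parent {b = b} (_ , a∈) =
    case subst (1 ≤_) (size {b} z≤n) (length≤∣ P b ∣ ([] ∷ []) λ { (here refl) → a∈ }) of λ ()

theorem14 : ∀ {n : ℕ} (G : Graph n) (k m : ℕ) (T : SimpleKTree k m) →
    SubgraphOfKTree G T → LocalTrackAtMost G k
theorem14 G zero    m T (f , f-inj , edges) =
  [] , (λ u v e → contradiction (edges u v e) (0-tree-edgeless T (f u) (f v))) , λ _ → z≤n
theorem14 G (suc k) m T (f , f-inj , edges) = pullback-localTrack G f f-inj
  (Construction.localTrack T (image G f f-inj)
    (λ a b e → case image-adj⁻ G f f-inj a b e of λ where
      (u , v , refl , refl , uv) → edges u v uv)
    (s≤s z≤n))
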